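{- If $P\subseteq\mathbb{R}^3$ determines a single $\ell^1$-distance, then $|P|\le 6$. Further, $|P|=6$ if and only if $P$ is $\ell^1$-similar to $\Lambda_3(1)=\{\pm e_1,\pm e_2,\pm e_3\}$.
   Context: For $x\in\mathbb{R}^3$, $\|x\|_1=|x_1|+|x_2|+|x_3|$; a set determines the distance $\lambda$ if $\lambda=\|x-y\|_1$ for two distinct points $x,y$ of the set; "determines a single distance" means exactly one nonzero distance occurs. $e_1,e_2,e_3$ are the standard basis vectors. Two subsets of $\mathbb{R}^d$ are $\ell^1$-similar if one can be mapped to the other by a composition of translations, reflections about coordinate hyperplanes, dilations, and coordinate permutations. -}

module Defs where

open import Level using (0ℓ)
open import Data.Nat using (ℕ)
open import Data.Bool using (Bool; true; false)
open import Data.Fin using (Fin; zero; suc)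
open import Data.Fin.Permutation using (Permutation′; _⟨$⟩ʳ_)
open import Data.Product using (Σ; ∃; _×_; _,_)
open import Data.Sum using (_⊎_)
open import Data.List using (List; []; _∷_)
open import Data.List.Membership.Propositional using (_∈_)
open import Relation.Nullary using (¬_)
open import Relation.Binary using (Tri; tri<; tri≈; tri>)
open import Relation.Binary.PropositionalEquality using (_≡_)
open import Relation.Binary.Structures using (IsStrictTotalOrder)
open import Algebra.Structures using (IsCommutativeRing)

-- The real numbers, axiomatised as a complete ordered field
-- (any model is isomorphic to ℝ).  The theorem is stated for every such model.
record RealField : Set₁ where
  infixl 6 _+_
  infixl 7 _*_
  infix 4 _<_ _≤_
  field
    R   : Set
    0# 1# : R
    _+_ _*_ : R → R → R
    -_  : R → R
    _<_ : R → R → Set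
    isCommutativeRing : IsCommutativeRing _≡_ _+_ _*_ -_ 0# 1#
    0≢1 : ¬ (0# ≡ 1#)
    inverse : ∀ x → ¬ (x ≡ 0#) → ∃ λ y → x * y ≡ 1#
    isStrictTotalOrder : IsStrictTotalOrder _≡_ _<_
    +-mono-< : ∀ {x y} z → x < y → x + z < y + z
    *-pos : ∀ {x y} → 0# < x → 0# < y → 0# < x * y
  _≤_ : R → R → Set
  x ≤ y = x < y ⊎ x ≡ y
  field
    sup : (S : R → Set) → (∃ λ x → S x) → (∃ λ b → ∀ x → S x → x ≤ b) →
          ∃ λ s → (∀ x → S x → x ≤ s) × (∀ b → (∀ x → S x → x ≤ b) → s ≤ b)

module _ (ℝ : RealField) where
  open RealField ℝ

  _-_ : R → R → R
  x - y = x + (- y)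

  ∣_∣ : R → R
  ∣ x ∣ with IsStrictTotalOrder.compare isStrictTotalOrder x 0#
  ... | tri< _ _ _ = - x
  ... | tri≈ _ _ _ = x
  ... | tri> _ _ _ = x

  Point : Set
  Point = R × R × R

  coord : Point → Fin 3 → R
  coord (a , b , c) zero = a
  coord (a , b , c) (suc zero) = b
  coord (a , b , c) (suc (suc zero)) = c

  fromCoords : (Fin 3 → R) → Point
  fromCoords f = f zero , f (suc zero) , f (suc (suc zero))

  dist₁ : Point → Point → R
  dist₁ (a₁ , a₂ , a₃) (b₁ , b₂ , b₃) = ∣ a₁ - b₁ ∣ + ∣ a₂ - b₂ ∣ + ∣ a₃ - b₃ ∣

  Subset : Set₁
  Subset = Point → Set

  SingleDistance : Subset → Set
  SingleDistance P =
    ∃ λ (λ₀ : R) →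
      (∃ λ x → ∃ λ y → P x × P y × ¬ (x ≡ y) × dist₁ x y ≡ λ₀) ×
      (∀ x y → P x → P y → ¬ (x ≡ y) → dist₁ x y ≡ λ₀)

  -- A composition of translations, reflections about coordinate hyperplanes,
  -- dilations (factor c > 0) and coordinate permutations has the normal form
  --   (f x)ᵢ = c · εᵢ · x_{π i} + tᵢ .
  record L1Similarity : Set where
    field
      perm  : Permutation′ 3
      signs : Fin 3 → Bool
      scale : R
      scale-pos : 0# < scale
      shift : Point

    apply : Point → Point
    apply x = fromCoords λ i →
      scale * sgn (signs i) (coord x (perm ⟨$⟩ʳ i)) + coord shift i
      where
      sgn : Bool → R → R
      sgn true  r = r
      sgn false r = - r

  Image : (Point → Point) → Subset → Subset
  Image f Q y = ∃ λ x → Q x × f x ≡ y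

  SameSet : Subset → Subset → Set
  SameSet P Q = ∀ x → (P x → Q x) × (Q x → P x)

  L1Similar : Subset → Subset → Set
  L1Similar P Q = (∃ λ (f : L1Similarity) → SameSet (Image (L1Similarity.apply f) P) Q)
                ⊎ (∃ λ (f : L1Similarity) → SameSet (Image (L1Similarity.apply f) Q) P)

  Λ₃-list : List Point
  Λ₃-list = (1# , 0# , 0#) ∷ (- 1# , 0# , 0#) ∷ (0# , 1# , 0#) ∷ (0# , - 1# , 0#)
          ∷ (0# , 0# , 1#) ∷ (0# , 0# , - 1#) ∷ []

  Λ₃ : Subset
  Λ₃ x = x ∈ Λ₃-list

{-# OPTIONS --safe #-}
-- Let D = 2ℓ be the common distance.  For three points the perimeter 6ℓ is twice the sum of the
-- three coordinate ranges, so if no coordinate spreads the set over more than ℓ, every triple has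
-- range ℓ in every coordinate; but among five points sorted by x, the triples 1,2,3 and 3,4,5
-- would then give a range of 2ℓ.  Hence, after permuting coordinates, the x-extreme points a and b
-- of six points satisfy x(b) - x(a) > ℓ.  Every other point c is at distance 2ℓ from both, so it
-- lies at distance ℓ from the box spanned by a and b, outside it in the directions y and z only,
-- which confines its y- and z-coordinates to an octagonal curve around a small rectangle.  Four
-- such points at mutual distance 2ℓ force this rectangle to be a point, and are then the four
-- vertices of an ℓ¹-circle of radius ℓ.  A seventh point would be equidistant from all six tips
-- of a cross, hence its centre, at the wrong distance ℓ.  The finitely many sign patterns of the
-- absolute values are searched by a verified decision procedure.
module Submission where

open import Defs
open import Algebra.Bundles using (CommutativeRing)
import Algebra.Properties.CommutativeMonoid.Mult
import Algebra.Properties.CommutativeSemigroup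
import Algebra.Properties.Monoid.Mult
import Algebra.Properties.Ring
open import Data.Bool using (Bool; true; false; _∧_; _∨_)
open import Data.Bool.ListAction using (any)
open import Data.Bool.Properties using (∧-conicalˡ; ∧-conicalʳ; ∨-idem)
open import Data.Empty using (⊥; ⊥-elim)
open import Data.Fin using (Fin; zero; suc; #_)
open import Data.Fin.Permutation using (_⟨$⟩ʳ_; _⟨$⟩ˡ_; inverseʳ)
import Data.Fin.Permutation as Permutation
open import Data.Integer as ℤ using (ℤ; +_; -[1+_]; +0; +[1+_])
import Data.Integer.Properties as ℤ
open import Data.List
  using (List; []; _∷_; _++_; map; foldl; length; take; drop; cartesianProductWith)
open import Data.List.Membership.Propositional using (_∈_)
open import Data.List.Membership.Propositional.Properties using (∈-map⁺; ∈-map⁻)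
open import Data.List.Properties using (length-map; length-take; map-id; map-cong; map-∘)
open import Data.List.Relation.Binary.Permutation.Propositional
  using (_↭_; prep; swap; ↭-refl; ↭-sym; ↭-trans; ↭-reflexive; ↭⇒↭ₛ; module PermutationReasoning)
open import Data.List.Relation.Binary.Permutation.Propositional.Properties
  using (All-resp-↭; ↭-length; ∈-resp-↭; ++-comm; ++⁺ʳ) renaming (map⁺ to ↭-map)
import Data.List.Relation.Binary.Permutation.Setoid.Properties as ↭ₛ
open import Data.List.Relation.Unary.All as All using (All; []; _∷_)
import Data.List.Relation.Unary.All.Properties as All
open import Data.List.Relation.Unary.AllPairs as AllPairs using (AllPairs; []; _∷_)
import Data.List.Relation.Unary.AllPairs.Properties as AllPairs
open import Data.List.Relation.Unary.Linked.Properties using (Linked⇒AllPairs)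
open import Data.List.Relation.Unary.Unique.Propositional using (Unique)
import Data.List.Relation.Unary.Unique.Propositional.Properties as Unique
import Data.List.Sort
open import Data.Nat as ℕ using (ℕ; zero; suc)
import Data.Nat.Properties as ℕ
open import Data.Product using (∃; _×_; _,_; proj₁; proj₂; map₂)
open import Data.Sum using (_⊎_; inj₁; inj₂)
open import Data.Vec as Vec using (Vec; []; _∷_; zipWith; replicate; lookup)
open import Function using (_∘_)
open import Function.Bundles using (_⇔_; mk⇔)
open import Relation.Binary using (DecTotalOrder; IsStrictTotalOrder; tri<; tri≈; tri>)
import Relation.Binary.Construct.On as On
import Relation.Binary.Properties.StrictTotalOrder
open import Relation.Binary.PropositionalEquality
open import Relation.Nullary using (¬_; yes; no)

-- Linear arithmetic with absolute values

-- Rows are homogeneous linear forms: lengths such as ℓ are variables themselves, so no condition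
-- carries a constant term.
Row : ℕ → Set
Row n = Vec ℤ n

infixl 6 _+ᴿ_
infix 8 -ᴿ_

_+ᴿ_ : ∀ {n} → Row n → Row n → Row n
_+ᴿ_ = zipWith ℤ._+_

-ᴿ_ : ∀ {n} → Row n → Row n
-ᴿ_ = Vec.map (ℤ.-_)

-- The multipliers are the successors of k and m: they must be positive for
-- strictness to survive.
combine : ∀ {n} → ℕ → Row n → ℕ → Row n → Row n
combine k []       m []       = []
combine k (+0 ∷ r) m (+0 ∷ s) = +0 ∷ combine k r m s
combine k (i ∷ r)  m (j ∷ s)  = +[1+ k ] ℤ.* i ℤ.+ +[1+ m ] ℤ.* j ∷ combine k r m s

unit : ∀ {n} → Fin n → Row n
unit zero    = + 1 ∷ replicate _ +0
unit (suc i) = +0 ∷ unit i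

-- (strict , r) stands for 0 < r or 0 ≤ r.
Ineq : ℕ → Set
Ineq n = Bool × Row n

-- Scaling crosswise by 1 + b and 1 + a makes the leading coefficients 1 + a and - (1 + b) cancel.
resolve : ∀ {n} → ℕ × Ineq n → ℕ × Ineq n → Ineq n
resolve (a , s , r) (b , t , r′) = s ∨ t , combine b r a r′

absurd : ∀ {n} → Ineq n → Bool
absurd (s , [])     = s
absurd (s , +0 ∷ r) = absurd (s , r)
absurd _            = false

mutual
  infeasible : ∀ {n} → List (Ineq n) → Bool
  infeasible {zero}  cs = any absurd cs
  infeasible {suc n} cs = eliminate cs [] [] []

  -- Fourier–Motzkin elimination of the first variable x: the accumulators hold
  -- lower bounds 0 ≤ (1 + a) x + r, upper bounds 0 ≤ - (1 + b) x + r, and the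
  -- inequalities that do not mention x.
  eliminate : ∀ {n} → List (Ineq (suc n)) →
              List (ℕ × Ineq n) → List (ℕ × Ineq n) → List (Ineq n) → Bool
  eliminate ((s , +[1+ a ] ∷ r) ∷ cs) ls us zs = eliminate cs ((a , s , r) ∷ ls) us zs
  eliminate ((s , -[1+ b ] ∷ r) ∷ cs) ls us zs = eliminate cs ls ((b , s , r) ∷ us) zs
  eliminate ((s , +0 ∷ r) ∷ cs)       ls us zs = eliminate cs ls us ((s , r) ∷ zs)
  eliminate []                        ls us zs = recurse (cartesianProductWith resolve ls us) zs

  recurse : ∀ {n} → List (Ineq n) → List (Ineq n) → Bool
  -- Elimination can square the number of inequalities, so a contradiction among the new resolvents
  -- ends the search before the next variable is touched.
  recurse rs zs = any absurd rs ∨ infeasible (rs ++ zs)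

-- The pivot of e is its first nonzero coefficient; it is paired with the entry of r that it has to
-- clear.
leading : ∀ {n} → Row n → Row n → ℤ × ℤ
leading []       []      = +0 , +0
leading (+0 ∷ e) (_ ∷ r) = leading e r
leading (i ∷ e)  (j ∷ r) = i , j

-- Only e may change sign. The row r is always scaled by the positive 1 + i, so that it may stand
-- for an inequality.
cancel : ∀ {n} → Row n → Row n → ℤ × ℤ → Row n
cancel e r (+[1+ i ] , +[1+ j ]) = combine i r j (-ᴿ e)
cancel e r (+[1+ i ] , -[1+ j ]) = combine i r j e
cancel e r (-[1+ i ] , +[1+ j ]) = combine i r j e
cancel e r (-[1+ i ] , -[1+ j ]) = combine i r j (-ᴿ e)
cancel e r _                     = r

substitute : ∀ {n} → Row n → Row n → Row n
substitute e r = cancel e r (leading e r)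

-- The search keeps the equations in echelon form: each is reduced by its predecessors before it is
-- appended. Inequalities reduced by all of them mention no pivot variable, and Fourier-Motzkin
-- elimination is left with the other variables.
record System (n : ℕ) : Set where
  constructor system
  field
    equations    : List (Row n)
    inequalities : List (Ineq n)
open System

reduce : ∀ {n} → System n → Row n → Row n
reduce s r = foldl (λ r e → substitute e r) r (equations s)

addEquation : ∀ {n} → Row n → System n → System n
addEquation e s = system (equations s ++ e ∷ [])
  (map (λ (b , r) → b , substitute e r) (inequalities s))

addInequality : ∀ {n} → Bool → Row n → System n → System n
addInequality b r s = system (equations s) ((b , reduce s r) ∷ inequalities s)

-- Formulas and the search for a refutation

infix  4 _≐_ _≼_ _≺_
infixl 6 _⊕_
infix  8 ⊝_

data Term (n : ℕ) : Set where
  var : Fin n → Term n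
  𝟎   : Term n
  _⊕_ : Term n → Term n → Term n
  ⊝_  : Term n → Term n
  ∣_∣ᵀ : Term n → Term n

data Formula (n : ℕ) : Set where
  _≐_ _≼_ _≺_ : Term n → Term n → Formula n

-- Testing at every addition prunes impossible sign patterns before further absolute values are
-- split.
branch : ∀ {n} → System n → (System n → Bool) → Bool
branch s k = infeasible (inequalities s) ∨ k s

-- In continuation-passing style, because an absolute value splits the search into two systems.
linearise : ∀ {n} → Term n → System n → (Row n → System n → Bool) → Bool
linearise (var i) s k = k (unit i) s
linearise 𝟎       s k = k (replicate _ +0) s
linearise (t ⊕ u) s k = linearise t s λ r s → linearise u s λ r′ s → k (r +ᴿ r′) s
linearise (⊝ t)   s k = linearise t s λ r s → k (-ᴿ r) s
linearise ∣ t ∣ᵀ   s k = linearise t s λ r s →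
  branch (addInequality false r s) (k r) ∧ branch (addInequality true (-ᴿ r) s) (k (-ᴿ r))

refutes : ∀ {n} → List (Formula n) → System n → Bool
-- Infeasibility was tested when the last hypothesis was added, so a branch that arrives here has
-- survived.
refutes []             s = false
refutes ((t ≐ u) ∷ hs) s = linearise (u ⊕ ⊝ t) s λ r s →
  branch (addEquation (reduce s r) s) (refutes hs)
refutes ((t ≼ u) ∷ hs) s = linearise (u ⊕ ⊝ t) s λ r s →
  branch (addInequality false r s) (refutes hs)
refutes ((t ≺ u) ∷ hs) s = linearise (u ⊕ ⊝ t) s λ r s →
  branch (addInequality true r s) (refutes hs)

-- The negated goal is placed before the hypotheses, so that it helps to prune from the start.
entails : ∀ {n} → List (Formula n) → Formula n → Bool
entails Γ (t ≐ u) = entails Γ (t ≼ u) ∧ entails Γ (u ≼ t)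
entails Γ (t ≼ u) = refutes ((u ≺ t) ∷ Γ) (system [] [])
entails Γ (t ≺ u) = refutes ((u ≼ t) ∷ Γ) (system [] [])

infix 3 _⊢_

-- A record rather than an abbreviation, so that comparing two such types never
-- runs the search again.
record _⊢_ {n} (Γ : List (Formula n)) (φ : Formula n) : Set where
  constructor checked
  field
    decision : entails Γ φ ≡ true

-- Point configurations handed to the search

Pointᵀ : ℕ → Set
Pointᵀ n = Term n × Term n × Term n

module _ {n : ℕ} where
  x y z : Pointᵀ n → Term n
  x (a , _ , _) = a
  y (_ , b , _) = b
  z (_ , _ , c) = c

  gap : Term n → Term n → Term n
  gap s t = ∣ s ⊕ ⊝ t ∣ᵀ

  distᵀ : Pointᵀ n → Pointᵀ n → Term n
  distᵀ p q = gap (x p) (x q) ⊕ gap (y p) (y q) ⊕ gap (z p) (z q)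

  -- The distance from p to q when p precedes q in the first (second) coordinate.
  xdistᵀ ydistᵀ : Pointᵀ n → Pointᵀ n → Term n
  xdistᵀ p q = (x q ⊕ ⊝ x p) ⊕ gap (y p) (y q) ⊕ gap (z p) (z q)
  ydistᵀ p q = gap (x p) (x q) ⊕ (y q ⊕ ⊝ y p) ⊕ gap (z p) (z q)

-- The points c, d, e, f are sorted by y, which removes the absolute values from their
-- y-differences.  The order of the variables and of the hypotheses keeps the search small.
module Ends where
  a b c d e f : Pointᵀ 19
  c = var (# 0) , var (# 1) , var (# 2)
  d = var (# 3) , var (# 4) , var (# 5)
  e = var (# 6) , var (# 7) , var (# 8)
  f = var (# 9) , var (# 10) , var (# 11)
  b = var (# 13) , var (# 14) , var (# 15)
  a = var (# 16) , var (# 17) , var (# 18)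

  ℓ : Term 19
  ℓ = var (# 12)

  Γ : List (Formula 19)
  Γ = (𝟎 ≺ ℓ) ∷ (x a ⊕ ℓ ≺ x b) ∷ (xdistᵀ a b ≐ ℓ ⊕ ℓ) ∷
      (xdistᵀ a c ≐ ℓ ⊕ ℓ) ∷ (xdistᵀ c b ≐ ℓ ⊕ ℓ) ∷ (x a ≼ x c) ∷ (x c ≼ x b) ∷
      (y c ≼ y d) ∷
      (xdistᵀ a d ≐ ℓ ⊕ ℓ) ∷ (xdistᵀ d b ≐ ℓ ⊕ ℓ) ∷ (x a ≼ x d) ∷ (x d ≼ x b) ∷
      (ydistᵀ c d ≐ ℓ ⊕ ℓ) ∷
      (y d ≼ y e) ∷
      (xdistᵀ a e ≐ ℓ ⊕ ℓ) ∷ (xdistᵀ e b ≐ ℓ ⊕ ℓ) ∷ (x a ≼ x e) ∷ (x e ≼ x b) ∷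
      (ydistᵀ c e ≐ ℓ ⊕ ℓ) ∷ (ydistᵀ d e ≐ ℓ ⊕ ℓ) ∷
      (y e ≼ y f) ∷
      (xdistᵀ a f ≐ ℓ ⊕ ℓ) ∷ (xdistᵀ f b ≐ ℓ ⊕ ℓ) ∷ (x a ≼ x f) ∷ (x f ≼ x b) ∷
      (ydistᵀ c f ≐ ℓ ⊕ ℓ) ∷ (ydistᵀ d f ≐ ℓ ⊕ ℓ) ∷ (ydistᵀ e f ≐ ℓ ⊕ ℓ) ∷ []

  -- The rectangle spanned by a and b has no extent in the direction y. The direction z follows by
  -- exchanging the two coordinates.
  y-level : Γ ⊢ y a ≐ y b
  y-level = checked refl

-- Four points at mutual distance 2ℓ on the ℓ¹-circle of radius ℓ around (`ay`, `az`). With c lowest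
-- and f highest in y, and d below e in z, the labelling is fixed and every coordinate is
-- determined. No order between `dy` and `ey` is assumed, which leaves d and e free to be named by
-- z.
module Planar where
  cy cz dy dz ey ez fy fz ℓ ay az : Term 11
  cy = var (# 0)
  cz = var (# 1)
  dy = var (# 2)
  dz = var (# 3)
  ey = var (# 4)
  ez = var (# 5)
  fy = var (# 6)
  fz = var (# 7)
  ℓ  = var (# 8)
  ay = var (# 9)
  az = var (# 10)

  Γ : List (Formula 11)
  Γ = (𝟎 ≺ ℓ) ∷
      (gap ay cy ⊕ gap az cz ≐ ℓ) ∷ (gap ay fy ⊕ gap az fz ≐ ℓ) ∷
      (cy ≼ fy) ∷ ((fy ⊕ ⊝ cy) ⊕ gap cz fz ≐ ℓ ⊕ ℓ) ∷
      (cy ≼ dy) ∷ (dy ≼ fy) ∷ (gap ay dy ⊕ gap az dz ≐ ℓ) ∷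
      ((dy ⊕ ⊝ cy) ⊕ gap cz dz ≐ ℓ ⊕ ℓ) ∷ ((fy ⊕ ⊝ dy) ⊕ gap dz fz ≐ ℓ ⊕ ℓ) ∷
      (cy ≼ ey) ∷ (ey ≼ fy) ∷ (dz ≼ ez) ∷ (gap ay ey ⊕ gap az ez ≐ ℓ) ∷
      ((ey ⊕ ⊝ cy) ⊕ gap cz ez ≐ ℓ ⊕ ℓ) ∷ ((fy ⊕ ⊝ ey) ⊕ gap ez fz ≐ ℓ ⊕ ℓ) ∷
      (gap dy ey ⊕ gap dz ez ≐ ℓ ⊕ ℓ) ∷ []

  c₁ : Γ ⊢ cy ≐ ay ⊕ ⊝ ℓ
  c₁ = checked refl
  c₂ : Γ ⊢ cz ≐ az
  c₂ = checked refl
  d₁ : Γ ⊢ dy ≐ ay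
  d₁ = checked refl
  d₂ : Γ ⊢ dz ≐ az ⊕ ⊝ ℓ
  d₂ = checked refl
  e₁ : Γ ⊢ ey ≐ ay
  e₁ = checked refl
  e₂ : Γ ⊢ ez ≐ az ⊕ ℓ
  e₂ = checked refl
  f₁ : Γ ⊢ fy ≐ ay ⊕ ℓ
  f₁ = checked refl
  f₂ : Γ ⊢ fz ≐ az
  f₂ = checked refl

-- Soundness over an ordered field

module OrderedField (ℝ : RealField) where
  open RealField ℝ hiding (_*_)

  commutativeRing : CommutativeRing _ _
  commutativeRing = record { isCommutativeRing = isCommutativeRing }

  open CommutativeRing commutativeRing using
    (+-comm; +-identityˡ; +-identityʳ; -‿inverseʳ; +-congˡ; +-congʳ;
     +-monoid; +-commutativeMonoid; ring)
  open Algebra.Properties.CommutativeSemigroup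
    (CommutativeRing.+-commutativeSemigroup commutativeRing) using (interchange)
  open Algebra.Properties.Ring ring using (-‿involutive; -‿+-comm; -0#≈0#)
  open Algebra.Properties.Monoid.Mult +-monoid
    using (×-homo-+; ×-assocˡ) renaming (_×_ to _×ᴿ_)
  open Algebra.Properties.CommutativeMonoid.Mult +-commutativeMonoid using (×-distrib-+)
  open IsStrictTotalOrder isStrictTotalOrder using (compare; irrefl) renaming (trans to <-trans)
  open ≡-Reasoning

  ×-neg : ∀ n x → n ×ᴿ (- x) ≡ - (n ×ᴿ x)
  ×-neg zero    x = sym -0#≈0#
  ×-neg (suc n) x = trans (+-congˡ (×-neg n x)) (-‿+-comm x (n ×ᴿ x))

  infixr 8 _·_

  _·_ : ℤ → R → R
  (+ n)    · x = n ×ᴿ x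
  -[1+ n ] · x = suc n ×ᴿ (- x)

  -- Sums of integers of opposite sign compute through `⊖`; each step of the recursion inserts x + -
  -- x.
  ⊖-· : ∀ m n x → (m ℤ.⊖ n) · x ≡ m ×ᴿ x + n ×ᴿ (- x)
  ⊖-· m       zero    x = sym (+-identityʳ _)
  ⊖-· zero    (suc n) x = sym (+-identityˡ _)
  ⊖-· (suc m) (suc n) x = begin
    (suc m ℤ.⊖ suc n) · x                    ≡⟨ cong (_· x) (ℤ.[1+m]⊖[1+n]≡m⊖n m n) ⟩
    (m ℤ.⊖ n) · x                            ≡⟨ ⊖-· m n x ⟩
    m ×ᴿ x + n ×ᴿ (- x)                      ≡⟨ +-identityˡ _ ⟨
    0# + (m ×ᴿ x + n ×ᴿ (- x))               ≡⟨ +-congʳ (-‿inverseʳ x) ⟨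
    x + - x + (m ×ᴿ x + n ×ᴿ (- x))          ≡⟨ interchange x (- x) _ _ ⟩
    (suc m ×ᴿ x) + (suc n ×ᴿ (- x))          ∎

  ·-distribʳ : ∀ i j x → (i ℤ.+ j) · x ≡ i · x + j · x
  ·-distribʳ (+ m)    (+ n)    x = ×-homo-+ x m n
  ·-distribʳ (+ m)    -[1+ n ] x = ⊖-· m (suc n) x
  ·-distribʳ -[1+ m ] (+ n)    x = trans (⊖-· n (suc m) x) (+-comm _ _)
  ·-distribʳ -[1+ m ] -[1+ n ] x = begin
    suc (suc (m ℕ.+ n)) ×ᴿ (- x)             ≡⟨ cong (λ k → suc k ×ᴿ (- x)) (ℕ.+-suc m n) ⟨
    (suc m ℕ.+ suc n) ×ᴿ (- x)               ≡⟨ ×-homo-+ (- x) (suc m) (suc n) ⟩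
    suc m ×ᴿ (- x) + suc n ×ᴿ (- x)          ∎

  ·-assoc : ∀ k i x → (+[1+ k ] ℤ.* i) · x ≡ suc k ×ᴿ (i · x)
  ·-assoc k (+ n)    x = begin
    (+[1+ k ] ℤ.* + n) · x                   ≡⟨ cong (_· x) (ℤ.pos-* (suc k) n) ⟨
    (suc k ℕ.* n) ×ᴿ x                       ≡⟨ ×-assocˡ x (suc k) n ⟨
    suc k ×ᴿ (n ×ᴿ x)                        ∎
  ·-assoc k -[1+ n ] x = sym (×-assocˡ (- x) (suc k) (suc n))

  ·-neg : ∀ i x → (ℤ.- i) · x ≡ - (i · x)
  ·-neg +0       x = sym -0#≈0#
  ·-neg +[1+ n ] x = ×-neg (suc n) x
  ·-neg -[1+ n ] x = begin
    suc n ×ᴿ x                               ≡⟨ -‿involutive _ ⟨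
    - - (suc n ×ᴿ x)                         ≡⟨ cong -_ (×-neg (suc n) x) ⟨
    - (suc n ×ᴿ (- x))                       ∎

  value : ∀ {n} → Vec R n → Row n → R
  value []      []      = 0#
  value (x ∷ ρ) (i ∷ r) = i · x + value ρ r

  value-+ : ∀ {n} (ρ : Vec R n) r s → value ρ (r +ᴿ s) ≡ value ρ r + value ρ s
  value-+ []      []      []      = sym (+-identityˡ 0#)
  value-+ (x ∷ ρ) (i ∷ r) (j ∷ s) = begin
    (i ℤ.+ j) · x + value ρ (r +ᴿ s)         ≡⟨ cong₂ _+_ (·-distribʳ i j x) (value-+ ρ r s) ⟩
    i · x + j · x + (value ρ r + value ρ s)  ≡⟨ interchange _ _ _ _ ⟩
    i · x + value ρ r + (j · x + value ρ s)  ∎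

  value-neg : ∀ {n} (ρ : Vec R n) r → value ρ (-ᴿ r) ≡ - value ρ r
  value-neg []      []      = sym -0#≈0#
  value-neg (x ∷ ρ) (i ∷ r) = trans (cong₂ _+_ (·-neg i x) (value-neg ρ r)) (-‿+-comm _ _)

  value-0 : ∀ {n} (ρ : Vec R n) → value ρ (replicate n +0) ≡ 0#
  value-0 []      = refl
  value-0 (x ∷ ρ) = trans (+-identityˡ _) (value-0 ρ)

  value-unit : ∀ {n} (ρ : Vec R n) i → value ρ (unit i) ≡ lookup ρ i
  value-unit (x ∷ ρ) zero    = trans (cong₂ _+_ (+-identityʳ x) (value-0 ρ)) (+-identityʳ x)
  value-unit (x ∷ ρ) (suc i) = trans (+-identityˡ _) (value-unit ρ i)

  ×-zero : ∀ n → n ×ᴿ 0# ≡ 0#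
  ×-zero zero    = refl
  ×-zero (suc n) = trans (+-identityˡ _) (×-zero n)

  value-combine : ∀ {n} (ρ : Vec R n) k r m s →
    value ρ (combine k r m s) ≡ suc k ×ᴿ value ρ r + suc m ×ᴿ value ρ s
  value-combine []      k []      m []      =
    sym (trans (cong₂ _+_ (×-zero (suc k)) (×-zero (suc m))) (+-identityˡ 0#))
  value-combine (x ∷ ρ) k (i ∷ r) m (j ∷ s) = begin
    value (x ∷ ρ) (combine k (i ∷ r) m (j ∷ s))
      ≡⟨ headwise i j ⟩
    (+[1+ k ] ℤ.* i ℤ.+ +[1+ m ] ℤ.* j) · x + value ρ (combine k r m s)
      ≡⟨ cong₂ _+_ (·-distribʳ (+[1+ k ] ℤ.* i) (+[1+ m ] ℤ.* j) x) (value-combine ρ k r m s) ⟩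
    (+[1+ k ] ℤ.* i) · x + (+[1+ m ] ℤ.* j) · x + (suc k ×ᴿ value ρ r + suc m ×ᴿ value ρ s)
      ≡⟨ +-congʳ (cong₂ _+_ (·-assoc k i x) (·-assoc m j x)) ⟩
    suc k ×ᴿ (i · x) + suc m ×ᴿ (j · x) + (suc k ×ᴿ value ρ r + suc m ×ᴿ value ρ s)
      ≡⟨ interchange _ _ _ _ ⟩
    suc k ×ᴿ (i · x) + suc k ×ᴿ value ρ r + (suc m ×ᴿ (j · x) + suc m ×ᴿ value ρ s)
      ≡⟨ cong₂ _+_ (×-distrib-+ _ _ (suc k)) (×-distrib-+ _ _ (suc m)) ⟨
    suc k ×ᴿ (i · x + value ρ r) + suc m ×ᴿ (j · x + value ρ s) ∎
    where
    -- `combine` short-cuts two zero coefficients to save multiplications in the search, so the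
    -- uniform formula has to be recovered by cases.
    headwise : ∀ i j → value (x ∷ ρ) (combine k (i ∷ r) m (j ∷ s)) ≡
      (+[1+ k ] ℤ.* i ℤ.+ +[1+ m ] ℤ.* j) · x + value ρ (combine k r m s)
    headwise +0       +0       = cong (λ n → n · x + value ρ (combine k r m s))
      (sym (cong₂ ℤ._+_ (ℤ.*-zeroʳ +[1+ k ]) (ℤ.*-zeroʳ +[1+ m ])))
    headwise +0       +[1+ _ ] = refl
    headwise +0       -[1+ _ ] = refl
    headwise +[1+ _ ] j        = refl
    headwise -[1+ _ ] j        = refl

  +-pos : ∀ {x y} → 0# < x → 0# < y → 0# < x + y
  +-pos {x} {y} 0<x 0<y =
    <-trans 0<y (subst (_< x + y) (+-identityˡ y) (+-mono-< y 0<x))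

  0≤+ : ∀ {x y} → 0# ≤ x → 0# ≤ y → 0# ≤ x + y
  0≤+ (inj₁ 0<x)  (inj₁ 0<y)  = inj₁ (+-pos 0<x 0<y)
  0≤+ (inj₁ 0<x)  (inj₂ refl) = inj₁ (subst (0# <_) (sym (+-identityʳ _)) 0<x)
  0≤+ (inj₂ refl) 0≤y         = subst (0# ≤_) (sym (+-identityˡ _)) 0≤y

  Positive : Bool → R → Set
  Positive true  x = 0# < x
  Positive false x = 0# ≤ x

  positive-+ : ∀ b c {x y} → Positive b x → Positive c y → Positive (b ∨ c) (x + y)
  positive-+ true  true  p        q          = +-pos p q
  positive-+ true  false p        (inj₁ q)   = +-pos p q
  positive-+ true  false p        (inj₂ refl) = subst (0# <_) (sym (+-identityʳ _)) p
  positive-+ false true  (inj₁ p) q          = +-pos p q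
  positive-+ false true  (inj₂ refl) q       = subst (0# <_) (sym (+-identityˡ _)) q
  positive-+ false false p        q          = 0≤+ p q

  positive-× : ∀ b k {x} → Positive b x → Positive b (suc k ×ᴿ x)
  positive-× b zero    p = subst (Positive b) (sym (+-identityʳ _)) p
  positive-× b (suc k) p =
    subst (λ c → Positive c _) (∨-idem b) (positive-+ b b p (positive-× b k p))

  ¬0<0 : ∀ b → b ≡ true → Positive b 0# → ⊥
  ¬0<0 true refl p = irrefl refl p

  module _ {n : ℕ} (ρ : Vec R n) where
    Zero : Row n → Set
    Zero e = value ρ e ≡ 0#

    Holds : Ineq n → Set
    Holds (b , r) = Positive b (value ρ r)

  value-cancel : ∀ {n} (ρ : Vec R n) k r m {e} → Zero ρ e →
    value ρ (combine k r m e) ≡ suc k ×ᴿ value ρ r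
  value-cancel ρ k r m {e} e≡0 = begin
    value ρ (combine k r m e)                ≡⟨ value-combine ρ k r m e ⟩
    suc k ×ᴿ value ρ r + suc m ×ᴿ value ρ e  ≡⟨ +-congˡ (cong (suc m ×ᴿ_) e≡0) ⟩
    suc k ×ᴿ value ρ r + suc m ×ᴿ 0#         ≡⟨ +-congˡ (×-zero (suc m)) ⟩
    suc k ×ᴿ value ρ r + 0#                  ≡⟨ +-identityʳ _ ⟩
    suc k ×ᴿ value ρ r                       ∎

  zero-neg : ∀ {n} (ρ : Vec R n) e → Zero ρ e → Zero ρ (-ᴿ e)
  zero-neg ρ e e≡0 = trans (value-neg ρ e) (trans (cong -_ e≡0) -0#≈0#)

  -- The equation contributes 0, and what remains is a positive multiple of r. Positivity and
  -- vanishing both survive such a factor, so this serves inequalities and equations alike.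
  value-substitute : ∀ {n} (ρ : Vec R n) e r → Zero ρ e →
    ∃ λ k → value ρ (substitute e r) ≡ suc k ×ᴿ value ρ r
  value-substitute ρ e r e≡0 = go (leading e r)
    where
    unchanged : ∃ λ k → value ρ r ≡ suc k ×ᴿ value ρ r
    unchanged = 0 , sym (+-identityʳ _)

    go : ∀ ij → ∃ λ k → value ρ (cancel e r ij) ≡ suc k ×ᴿ value ρ r
    go (+[1+ i ] , +[1+ j ]) = i , value-cancel ρ i r j (zero-neg ρ e e≡0)
    go (+[1+ i ] , -[1+ j ]) = i , value-cancel ρ i r j e≡0
    go (-[1+ i ] , +[1+ j ]) = i , value-cancel ρ i r j e≡0
    go (-[1+ i ] , -[1+ j ]) = i , value-cancel ρ i r j (zero-neg ρ e e≡0)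
    go (+0       , _)        = unchanged
    go (+[1+ _ ] , +0)       = unchanged
    go (-[1+ _ ] , +0)       = unchanged

  holds-substitute : ∀ {n} (ρ : Vec R n) e b r → Zero ρ e →
    Holds ρ (b , r) → Holds ρ (b , substitute e r)
  holds-substitute ρ e b r e≡0 h with value-substitute ρ e r e≡0
  ... | k , eq = subst (Positive b) (sym eq) (positive-× b k h)

  zero-substitute : ∀ {n} (ρ : Vec R n) e r → Zero ρ e → Zero ρ r → Zero ρ (substitute e r)
  zero-substitute ρ e r e≡0 r≡0 with value-substitute ρ e r e≡0
  ... | k , eq = trans eq (trans (cong (suc k ×ᴿ_) r≡0) (×-zero (suc k)))

  holds-resolve : ∀ {n} x (ρ : Vec R n) a b s t r r′ →
    Holds (x ∷ ρ) (s , +[1+ a ] ∷ r) → Holds (x ∷ ρ) (t , -[1+ b ] ∷ r′) →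
    Holds ρ (resolve (a , s , r) (b , t , r′))
  holds-resolve x ρ a b s t r r′ p q = subst (Positive (s ∨ t)) eq
    (positive-+ s t (positive-× s b p) (positive-× t a q))
    where
    cancels : suc b ×ᴿ (suc a ×ᴿ x) + suc a ×ᴿ (suc b ×ᴿ (- x)) ≡ 0#
    cancels = begin
      suc b ×ᴿ (suc a ×ᴿ x) + suc a ×ᴿ (suc b ×ᴿ (- x))
        ≡⟨ cong₂ _+_ (×-assocˡ x (suc b) (suc a)) (×-assocˡ (- x) (suc a) (suc b)) ⟩
      (suc b ℕ.* suc a) ×ᴿ x + (suc a ℕ.* suc b) ×ᴿ (- x)
        ≡⟨ +-congˡ (cong (_×ᴿ (- x)) (ℕ.*-comm (suc a) (suc b))) ⟩
      (suc b ℕ.* suc a) ×ᴿ x + (suc b ℕ.* suc a) ×ᴿ (- x)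
        ≡⟨ +-congˡ (×-neg (suc b ℕ.* suc a) x) ⟩
      (suc b ℕ.* suc a) ×ᴿ x + - ((suc b ℕ.* suc a) ×ᴿ x)
        ≡⟨ -‿inverseʳ _ ⟩
      0# ∎

    eq : suc b ×ᴿ (suc a ×ᴿ x + value ρ r) + suc a ×ᴿ (suc b ×ᴿ (- x) + value ρ r′) ≡
         value ρ (combine b r a r′)
    eq = begin
      suc b ×ᴿ (suc a ×ᴿ x + value ρ r) + suc a ×ᴿ (suc b ×ᴿ (- x) + value ρ r′)
        ≡⟨ cong₂ _+_ (×-distrib-+ _ _ (suc b)) (×-distrib-+ _ _ (suc a)) ⟩
      (suc b ×ᴿ (suc a ×ᴿ x) + suc b ×ᴿ value ρ r) +
      (suc a ×ᴿ (suc b ×ᴿ (- x)) + suc a ×ᴿ value ρ r′)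
        ≡⟨ interchange _ _ _ _ ⟩
      (suc b ×ᴿ (suc a ×ᴿ x) + suc a ×ᴿ (suc b ×ᴿ (- x))) +
      (suc b ×ᴿ value ρ r + suc a ×ᴿ value ρ r′)
        ≡⟨ +-congʳ cancels ⟩
      0# + (suc b ×ᴿ value ρ r + suc a ×ᴿ value ρ r′)
        ≡⟨ +-identityˡ _ ⟩
      suc b ×ᴿ value ρ r + suc a ×ᴿ value ρ r′
        ≡⟨ value-combine ρ b r a r′ ⟨
      value ρ (combine b r a r′) ∎

  absurd-sound : ∀ {n} (ρ : Vec R n) c → absurd c ≡ true → Holds ρ c → ⊥
  absurd-sound []      (b , [])     ok h = ¬0<0 b ok h
  absurd-sound (x ∷ ρ) (b , +0 ∷ r) ok h =
    absurd-sound ρ (b , r) ok (subst (Positive b) (+-identityˡ _) h)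

  any-absurd-sound : ∀ {n} (ρ : Vec R n) cs → any absurd cs ≡ true → All (Holds ρ) cs → ⊥
  any-absurd-sound ρ (c ∷ cs) ok (h ∷ hs) with absurd c in eq
  ... | true  = absurd-sound ρ c eq h
  ... | false = any-absurd-sound ρ cs ok hs

  mutual
    infeasible-sound : ∀ {n} (ρ : Vec R n) cs → infeasible cs ≡ true → All (Holds ρ) cs → ⊥
    infeasible-sound []      cs ok hs = any-absurd-sound [] cs ok hs
    infeasible-sound (x ∷ ρ) cs ok hs = eliminate-sound x ρ cs [] [] [] ok hs [] [] []

    -- The hypotheses on the accumulators put back the coefficient of x that `eliminate` has split
    -- off.
    eliminate-sound : ∀ {n} x (ρ : Vec R n) cs ls us zs → eliminate cs ls us zs ≡ true →
      All (Holds (x ∷ ρ)) cs →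
      All (λ (a , s , r) → Holds (x ∷ ρ) (s , +[1+ a ] ∷ r)) ls →
      All (λ (b , s , r) → Holds (x ∷ ρ) (s , -[1+ b ] ∷ r)) us →
      All (Holds ρ) zs → ⊥
    eliminate-sound x ρ ((s , +[1+ a ] ∷ r) ∷ cs) ls us zs ok (h ∷ hs) hl hu hz =
      eliminate-sound x ρ cs _ us zs ok hs (h ∷ hl) hu hz
    eliminate-sound x ρ ((s , -[1+ b ] ∷ r) ∷ cs) ls us zs ok (h ∷ hs) hl hu hz =
      eliminate-sound x ρ cs ls _ zs ok hs hl (h ∷ hu) hz
    eliminate-sound x ρ ((s , +0 ∷ r) ∷ cs)       ls us zs ok (h ∷ hs) hl hu hz =
      eliminate-sound x ρ cs ls us _ ok hs hl hu (subst (Positive s) (+-identityˡ _) h ∷ hz)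
    eliminate-sound x ρ [] ls us zs ok [] hl hu hz = recurse-sound ρ _ zs ok
      (All.cartesianProductWith⁺ (setoid _) (setoid _) resolve ls us
        (λ {(a , s , r)} {(b , t , r′)} l∈ u∈ →
          holds-resolve x ρ a b s t r r′ (All.lookup hl l∈) (All.lookup hu u∈)))
      hz

    recurse-sound : ∀ {n} (ρ : Vec R n) rs zs → recurse rs zs ≡ true →
      All (Holds ρ) rs → All (Holds ρ) zs → ⊥
    recurse-sound ρ rs zs ok hr hz with any absurd rs in eq
    ... | true  = any-absurd-sound ρ rs eq hr
    ... | false = infeasible-sound ρ (rs ++ zs) ok (All.++⁺ hr hz)

  -- Soundness of the search

  abs-cases : ∀ x → (0# ≤ x × ∣_∣ ℝ x ≡ x) ⊎ (0# < - x × ∣_∣ ℝ x ≡ - x)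
  abs-cases x with compare x 0#
  ... | tri< x<0 _ _ = inj₂ (subst₂ _<_ (-‿inverseʳ x) (+-identityˡ _) (+-mono-< (- x) x<0) , refl)
  ... | tri≈ _ x≡0 _ = inj₁ (inj₂ (sym x≡0) , refl)
  ... | tri> _ _ 0<x = inj₁ (inj₁ 0<x , refl)

  <⇒0< : ∀ {x y} → x < y → 0# < y + - x
  <⇒0< {x} x<y = subst (_< _) (-‿inverseʳ x) (+-mono-< (- x) x<y)

  ≤⇒0≤ : ∀ {x y} → x ≤ y → 0# ≤ y + - x
  ≤⇒0≤ (inj₁ x<y)      = inj₁ (<⇒0< x<y)
  ≤⇒0≤ {x} (inj₂ refl) = inj₂ (sym (-‿inverseʳ x))

  ≤-or-> : ∀ x y → x ≤ y ⊎ y < x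
  ≤-or-> x y with compare x y
  ... | tri< x<y _ _ = inj₁ (inj₁ x<y)
  ... | tri≈ _ x≡y _ = inj₁ (inj₂ x≡y)
  ... | tri> _ _ y<x = inj₂ y<x

  ≤-antisym : ∀ {x y} → x ≤ y → y ≤ x → x ≡ y
  ≤-antisym (inj₂ x≡y) _          = x≡y
  ≤-antisym (inj₁ _)   (inj₂ y≡x) = sym y≡x
  ≤-antisym (inj₁ x<y) (inj₁ y<x) = ⊥-elim (irrefl refl (<-trans x<y y<x))

  module _ {n : ℕ} (ρ : Vec R n) where
    Model : System n → Set
    Model s = All (Zero ρ) (equations s) × All (Holds ρ) (inequalities s)

    ⟦_⟧ : Term n → R
    ⟦ var i ⟧ = lookup ρ i
    ⟦ 𝟎 ⟧     = 0#
    ⟦ t ⊕ u ⟧ = ⟦ t ⟧ + ⟦ u ⟧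
    ⟦ ⊝ t ⟧   = - ⟦ t ⟧
    ⟦ ∣ t ∣ᵀ ⟧ = ∣_∣ ℝ ⟦ t ⟧

    ⟦_⟧ᶠ : Formula n → Set
    ⟦ t ≐ u ⟧ᶠ = ⟦ t ⟧ ≡ ⟦ u ⟧
    ⟦ t ≼ u ⟧ᶠ = ⟦ t ⟧ ≤ ⟦ u ⟧
    ⟦ t ≺ u ⟧ᶠ = ⟦ t ⟧ < ⟦ u ⟧

    reduce-holds : ∀ {es} → All (Zero ρ) es → ∀ b r → Holds ρ (b , r) →
      Holds ρ (b , foldl (λ r e → substitute e r) r es)
    reduce-holds []                   b r h = h
    reduce-holds (_∷_ {x = e} e≡0 es) b r h = reduce-holds es b _ (holds-substitute ρ e b r e≡0 h)

    reduce-zero : ∀ {es} → All (Zero ρ) es → ∀ r → Zero ρ r →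
      Zero ρ (foldl (λ r e → substitute e r) r es)
    reduce-zero []                   r h = h
    reduce-zero (_∷_ {x = e} e≡0 es) r h = reduce-zero es _ (zero-substitute ρ e r e≡0 h)

    addInequality-model : ∀ b r s → Model s → Holds ρ (b , r) → Model (addInequality b r s)
    addInequality-model b r s (es , cs) h = es , reduce-holds es b r h ∷ cs

    addEquation-model : ∀ e s → Model s → Zero ρ e → Model (addEquation e s)
    addEquation-model e s (es , cs) e≡0 =
      All.++⁺ es (e≡0 ∷ []) , All.map⁺ (All.map (λ {(b , r)} → holds-substitute ρ e b r e≡0) cs)

    -- A system with a model is not infeasible, so acceptance must have come from the continuation.
    branch-sound : ∀ s k → branch s k ≡ true → Model s → k s ≡ true
    branch-sound s k ok (_ , cs) with infeasible (inequalities s) in eq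
    ... | true  = ⊥-elim (infeasible-sound ρ _ eq cs)
    ... | false = ok

    -- Of all the systems into which the absolute values split the search, the proof follows the one
    -- whose signs agree with ρ.
    linearise-sound : ∀ t s k → linearise t s k ≡ true → Model s →
      ∃ λ r → ∃ λ s′ → value ρ r ≡ ⟦ t ⟧ × Model s′ × k r s′ ≡ true
    linearise-sound (var i) s k ok m = _ , _ , value-unit ρ i , m , ok
    linearise-sound 𝟎       s k ok m = _ , _ , value-0 ρ , m , ok
    linearise-sound (t ⊕ u) s k ok m with linearise-sound t s _ ok m
    ... | r , s , r≡t , m , ok with linearise-sound u s _ ok m
    ...   | r′ , _ , r′≡u , m , ok =
      _ , _ , trans (value-+ ρ r r′) (cong₂ _+_ r≡t r′≡u) , m , ok
    linearise-sound (⊝ t)   s k ok m with linearise-sound t s _ ok m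
    ... | r , _ , r≡t , m , ok = _ , _ , trans (value-neg ρ r) (cong -_ r≡t) , m , ok
    linearise-sound ∣ t ∣ᵀ   s k ok m with linearise-sound t s _ ok m
    ... | r , s , r≡t , m , ok with abs-cases ⟦ t ⟧
    ...   | inj₁ (0≤t , ∣t∣≡t) =
      _ , _ , trans r≡t (sym ∣t∣≡t) , m′ , branch-sound _ (k r) (∧-conicalˡ _ _ ok) m′
      where m′ = addInequality-model false r s m (subst (0# ≤_) (sym r≡t) 0≤t)
    ...   | inj₂ (0<-t , ∣t∣≡-t) =
      _ , _ , trans -r≡-t (sym ∣t∣≡-t) , m′ , branch-sound _ (k (-ᴿ r)) (∧-conicalʳ _ _ ok) m′
      where
      -r≡-t = trans (value-neg ρ r) (cong -_ r≡t)
      m′ = addInequality-model true (-ᴿ r) s m (subst (0# <_) (sym -r≡-t) 0<-t)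

    refutes-sound : ∀ hs s → refutes hs s ≡ true → Model s → All ⟦_⟧ᶠ hs → ⊥
    refutes-sound ((t ≐ u) ∷ hs) s ok m (h ∷ ps) with linearise-sound (u ⊕ ⊝ t) s _ ok m
    ... | r , s , r≡ , m , ok = refutes-sound hs _ (branch-sound _ (refutes hs) ok m′) m′ ps
      where
      m′ = addEquation-model _ s m (reduce-zero (proj₁ m) r
        (trans r≡ (trans (cong (λ v → v + - ⟦ t ⟧) (sym h)) (-‿inverseʳ ⟦ t ⟧))))
    refutes-sound ((t ≼ u) ∷ hs) s ok m (h ∷ ps) with linearise-sound (u ⊕ ⊝ t) s _ ok m
    ... | r , s , r≡ , m , ok = refutes-sound hs _ (branch-sound _ (refutes hs) ok m′) m′ ps
      where m′ = addInequality-model false r s m (subst (0# ≤_) (sym r≡) (≤⇒0≤ h))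
    refutes-sound ((t ≺ u) ∷ hs) s ok m (h ∷ ps) with linearise-sound (u ⊕ ⊝ t) s _ ok m
    ... | r , s , r≡ , m , ok = refutes-sound hs _ (branch-sound _ (refutes hs) ok m′) m′ ps
      where m′ = addInequality-model true r s m (subst (0# <_) (sym r≡) (<⇒0< h))

    entails-sound : ∀ Γ φ → entails Γ φ ≡ true → All ⟦_⟧ᶠ Γ → ⟦ φ ⟧ᶠ
    entails-sound Γ (t ≐ u) ok hs = ≤-antisym
      (entails-sound Γ (t ≼ u) (∧-conicalˡ _ _ ok) hs)
      (entails-sound Γ (u ≼ t) (∧-conicalʳ _ _ ok) hs)
    entails-sound Γ (t ≼ u) ok hs with ≤-or-> ⟦ t ⟧ ⟦ u ⟧
    ... | inj₁ t≤u = t≤u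
    ... | inj₂ u<t = ⊥-elim (refutes-sound ((u ≺ t) ∷ Γ) _ ok ([] , []) (u<t ∷ hs))
    entails-sound Γ (t ≺ u) ok hs with ≤-or-> ⟦ u ⟧ ⟦ t ⟧
    ... | inj₁ u≤t = ⊥-elim (refutes-sound ((u ≼ t) ∷ Γ) _ ok ([] , []) (u≤t ∷ hs))
    ... | inj₂ t<u = t<u

    linarith : ∀ {Γ φ} → Γ ⊢ φ → All ⟦_⟧ᶠ Γ → ⟦ φ ⟧ᶠ
    linarith {Γ} {φ} (checked ok) = entails-sound Γ φ ok

-- Equilateral sets

module Equilateral (ℝ : RealField) where
  open RealField ℝ
  open OrderedField ℝ
  open IsStrictTotalOrder isStrictTotalOrder using (irrefl)
  open CommutativeRing commutativeRing
    using (+-assoc; +-comm; +-congˡ; +-identityˡ; +-identityʳ; -‿inverseʳ)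

  δ : R → R → R
  δ s t = ∣_∣ ℝ (s + - t)

  X Y Z : Point ℝ → R
  X (s , _ , _) = s
  Y (_ , s , _) = s
  Z (_ , _ , s) = s

  point-≡ : ∀ p {s t u} → X p ≡ s → Y p ≡ t → Z p ≡ u → p ≡ (s , t , u)
  point-≡ p xp yp zp = cong₂ _,_ xp (cong₂ _,_ yp zp)

  coords : Point ℝ → Vec R 3
  coords (s , t , u) = s ∷ t ∷ u ∷ []

  fst₂ snd₂ : Pointᵀ 6
  fst₂ = var (# 0) , var (# 1) , var (# 2)
  snd₂ = var (# 3) , var (# 4) , var (# 5)

  dist-sym : ∀ p q → dist₁ ℝ p q ≡ dist₁ ℝ q p
  dist-sym p q = linarith (coords p Vec.++ coords q) {φ = distᵀ fst₂ snd₂ ≐ distᵀ snd₂ fst₂}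
    (checked refl) []

  dist≤0⇒≡ : ∀ p q → dist₁ ℝ p q ≤ 0# → p ≡ q
  dist≤0⇒≡ p q d≤0 = cong₂ _,_ (coordinate x (checked refl))
    (cong₂ _,_ (coordinate y (checked refl)) (coordinate z (checked refl)))
    where
    ρ = coords p Vec.++ coords q
    coordinate : ∀ c → (distᵀ fst₂ snd₂ ≼ 𝟎) ∷ [] ⊢ c fst₂ ≐ c snd₂ →
      ⟦_⟧ ρ (c fst₂) ≡ ⟦_⟧ ρ (c snd₂)
    coordinate c ok = linarith ρ ok (d≤0 ∷ [])

  δ-ordered : ∀ s t → s ≤ t → δ s t ≡ t + - s
  δ-ordered s t s≤t = linarith (s ∷ t ∷ [])
    {(var (# 0) ≼ var (# 1)) ∷ []} {gap (var (# 0)) (var (# 1)) ≐ var (# 1) ⊕ ⊝ var (# 0)}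
    (checked refl) (s≤t ∷ [])

  xdist : ∀ p q → X p ≤ X q → (X q + - X p) + δ (Y p) (Y q) + δ (Z p) (Z q) ≡ dist₁ ℝ p q
  xdist p q p≤q = cong (λ s → s + δ (Y p) (Y q) + δ (Z p) (Z q)) (sym (δ-ordered (X p) (X q) p≤q))

  ydist : ∀ p q → Y p ≤ Y q → δ (X p) (X q) + (Y q + - Y p) + δ (Z p) (Z q) ≡ dist₁ ℝ p q
  ydist p q p≤q = cong (λ s → δ (X p) (X q) + s + δ (Z p) (Z q)) (sym (δ-ordered (Y p) (Y q) p≤q))

  -- On a line the three gaps of a triple add up to twice its range.
  perimeter : ∀ r s t lo ℓ → All (λ u → lo ≤ u × u ≤ lo + ℓ) (r ∷ s ∷ t ∷ []) →
    δ r s + δ r t + δ s t ≤ ℓ + ℓ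
  perimeter r s t lo ℓ ((lo≤r , r≤hi) ∷ (lo≤s , s≤hi) ∷ (lo≤t , t≤hi) ∷ []) =
    linarith (r ∷ s ∷ t ∷ lo ∷ ℓ ∷ [])
      {(v₃ ≼ v₀) ∷ (v₀ ≼ v₃ ⊕ v₄) ∷ (v₃ ≼ v₁) ∷ (v₁ ≼ v₃ ⊕ v₄) ∷ (v₃ ≼ v₂) ∷ (v₂ ≼ v₃ ⊕ v₄) ∷ []}
      {gap v₀ v₁ ⊕ gap v₀ v₂ ⊕ gap v₁ v₂ ≼ v₄ ⊕ v₄} (checked refl)
      (lo≤r ∷ r≤hi ∷ lo≤s ∷ s≤hi ∷ lo≤t ∷ t≤hi ∷ [])
    where
    v₀ v₁ v₂ v₃ v₄ : Term 5
    v₀ = var (# 0)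
    v₁ = var (# 1)
    v₂ = var (# 2)
    v₃ = var (# 3)
    v₄ = var (# 4)

  ≤-decTotalOrder : DecTotalOrder _ _ _
  ≤-decTotalOrder = Relation.Binary.Properties.StrictTotalOrder.decTotalOrder
    (record { isStrictTotalOrder = isStrictTotalOrder })

  open DecTotalOrder ≤-decTotalOrder using () renaming (trans to ≤-trans)

  sortBy : (κ : Point ℝ → R) → ∀ ps → ∃ λ qs → qs ↭ ps × AllPairs (λ p q → κ p ≤ κ q) qs
  sortBy κ ps = sort ps , sort-↭ ps , Linked⇒AllPairs (≤-trans) (sort-↗ ps)
    where open Data.List.Sort (On.decTotalOrder ≤-decTotalOrder κ)

  -- Equilateral lists with common distance 2ℓ

  module _ (ℓ : R) (0<ℓ : 0# < ℓ) where
    Equilateral : List (Point ℝ) → Set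
    Equilateral = AllPairs (λ p q → dist₁ ℝ p q ≡ ℓ + ℓ)

    equilateral-↭ : ∀ {ps qs} → ps ↭ qs → Equilateral ps → Equilateral qs
    equilateral-↭ σ = ↭ₛ.AllPairs-resp-↭ (setoid (Point ℝ)) (λ {p} {q} h → trans (dist-sym q p) h)
      ((λ { refl h → h }) , (λ { refl h → h })) (↭⇒↭ₛ σ)

    Narrow : (Point ℝ → R) → List (Point ℝ) → Set
    Narrow κ ps = ∃ λ lo → All (λ p → lo ≤ κ p × κ p ≤ lo + ℓ) ps

    -- The perimeter of the triangle is 6ℓ, of which the y- and z-coordinates
    -- contribute at most 2ℓ each.
    x-spread : ∀ p q r → Equilateral (p ∷ q ∷ r ∷ []) → X p ≤ X q → X q ≤ X r →
      Narrow Y (p ∷ q ∷ r ∷ []) → Narrow Z (p ∷ q ∷ r ∷ []) → X p + ℓ ≤ X r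
    x-spread p q r ((pq ∷ pr ∷ []) ∷ (qr ∷ []) ∷ [] ∷ []) p≤q q≤r (loY , inY) (loZ , inZ) =
      linarith (X p ∷ X q ∷ X r ∷ δ (Y p) (Y q) ∷ δ (Y p) (Y r) ∷ δ (Y q) (Y r) ∷
                δ (Z p) (Z q) ∷ δ (Z p) (Z r) ∷ δ (Z q) (Z r) ∷ ℓ ∷ [])
        {(xp ≼ xq) ∷ (xq ≼ xr) ∷
         (gap xp xq ⊕ ypq ⊕ zpq ≐ l ⊕ l) ∷ (gap xp xr ⊕ ypr ⊕ zpr ≐ l ⊕ l) ∷
         (gap xq xr ⊕ yqr ⊕ zqr ≐ l ⊕ l) ∷
         (ypq ⊕ ypr ⊕ yqr ≼ l ⊕ l) ∷ (zpq ⊕ zpr ⊕ zqr ≼ l ⊕ l) ∷ []}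
        {xp ⊕ l ≼ xr} (checked refl)
        (p≤q ∷ q≤r ∷ pq ∷ pr ∷ qr ∷ perimeter _ _ _ loY ℓ (All.map⁺ inY)
          ∷ perimeter _ _ _ loZ ℓ (All.map⁺ inZ) ∷ [])
      where
      xp xq xr ypq ypr yqr zpq zpr zqr l : Term 10
      xp  = var (# 0)
      xq  = var (# 1)
      xr  = var (# 2)
      ypq = var (# 3)
      ypr = var (# 4)
      yqr = var (# 5)
      zpq = var (# 6)
      zpr = var (# 7)
      zqr = var (# 8)
      l   = var (# 9)

    ¬all-narrow : ∀ ps → length ps ≡ 6 → Equilateral ps →
      Narrow X ps → Narrow Y ps → Narrow Z ps → ⊥
    ¬all-narrow ps six eq (loX , inX) (loY , inY) (loZ , inZ)
      with sortBy X ps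
    ... | qs , σ , sorted
      with qs | trans (↭-length σ) six | equilateral-↭ (↭-sym σ) eq | sorted
         | All-resp-↭ (↭-sym σ) inX | All-resp-↭ (↭-sym σ) inY | All-resp-↭ (↭-sym σ) inZ
    ... | p₁ ∷ p₂ ∷ p₃ ∷ p₄ ∷ p₅ ∷ p₆ ∷ [] | _
        | (d₁₂ ∷ d₁₃ ∷ _) ∷ (d₂₃ ∷ _) ∷ (d₃₄ ∷ d₃₅ ∷ _) ∷ (d₄₅ ∷ _) ∷ _
        | (1≤2 ∷ _) ∷ (2≤3 ∷ _) ∷ (3≤4 ∷ _) ∷ (4≤5 ∷ _) ∷ _
        | (lo≤1 , _) ∷ _ ∷ _ ∷ _ ∷ (_ , 5≤hi) ∷ _
        | y₁ ∷ y₂ ∷ y₃ ∷ y₄ ∷ y₅ ∷ _ | z₁ ∷ z₂ ∷ z₃ ∷ z₄ ∷ z₅ ∷ _ =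
      -- The goal `l ≺ l` stands for falsity: its negation says nothing, so the hypotheses
      -- themselves are refuted.
      irrefl refl (linarith (X p₁ ∷ X p₃ ∷ X p₅ ∷ loX ∷ ℓ ∷ [])
        {(𝟎 ≺ l) ∷ (lo ≼ x₁) ∷ (x₁ ⊕ l ≼ x₃) ∷ (x₃ ⊕ l ≼ x₅) ∷ (x₅ ≼ lo ⊕ l) ∷ []}
        {l ≺ l} (checked refl)
        (0<ℓ ∷ lo≤1 ∷
         x-spread p₁ p₂ p₃ ((d₁₂ ∷ d₁₃ ∷ []) ∷ (d₂₃ ∷ []) ∷ [] ∷ []) 1≤2 2≤3
           (loY , y₁ ∷ y₂ ∷ y₃ ∷ []) (loZ , z₁ ∷ z₂ ∷ z₃ ∷ []) ∷
         x-spread p₃ p₄ p₅ ((d₃₄ ∷ d₃₅ ∷ []) ∷ (d₄₅ ∷ []) ∷ [] ∷ []) 3≤4 4≤5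
           (loY , y₃ ∷ y₄ ∷ y₅ ∷ []) (loZ , z₃ ∷ z₄ ∷ z₅ ∷ []) ∷
         5≤hi ∷ []))
      where
      x₁ x₃ x₅ lo l : Term 5
      x₁ = var (# 0)
      x₃ = var (# 1)
      x₅ = var (# 2)
      lo = var (# 3)
      l  = var (# 4)

    -- Since a and b have distance 2ℓ and differ by more than ℓ in x, the rectangle they span in y
    -- and z has sides of sum below ℓ.
    record Slab (a b : Point ℝ) (ps : List (Point ℝ)) : Set where
      field
        equilateral : Equilateral (a ∷ b ∷ ps)
        wide        : X a + ℓ < X b
        within      : All (λ p → X a ≤ X p × X p ≤ X b) ps
        four        : length ps ≡ 4

    slab-level : ∀ a b ps → Slab a b ps → Y a ≡ Y b
    slab-level a b ps S with sortBy Y ps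
    ... | qs , σ , sorted
      with qs | trans (↭-length σ) (Slab.four S) | All-resp-↭ (↭-sym σ) (Slab.within S) | sorted
         | equilateral-↭ (prep a (prep b (↭-sym σ))) (Slab.equilateral S)
    ... | c ∷ d ∷ e ∷ f ∷ [] | _
        | (a≤c , c≤b) ∷ (a≤d , d≤b) ∷ (a≤e , e≤b) ∷ (a≤f , f≤b) ∷ []
        | (cd ∷ ce ∷ cf ∷ []) ∷ (de ∷ df ∷ []) ∷ (ef ∷ []) ∷ [] ∷ []
        | (ab′ ∷ ac′ ∷ ad′ ∷ ae′ ∷ af′ ∷ []) ∷ (bc′ ∷ bd′ ∷ be′ ∷ bf′ ∷ []) ∷
          (cd′ ∷ ce′ ∷ cf′ ∷ []) ∷ (de′ ∷ df′ ∷ []) ∷ (ef′ ∷ []) ∷ [] ∷ [] =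
      -- The order is the variable numbering of `Ends`.
      linarith (coords c Vec.++ coords d Vec.++ coords e Vec.++ coords f Vec.++
                ℓ ∷ coords b Vec.++ coords a)
        Ends.y-level
        (0<ℓ ∷ Slab.wide S ∷ fromX a b (≤-trans a≤c c≤b) ab′ ∷
         fromX a c a≤c ac′ ∷ toX c c≤b bc′ ∷ a≤c ∷ c≤b ∷ cd ∷
         fromX a d a≤d ad′ ∷ toX d d≤b bd′ ∷ a≤d ∷ d≤b ∷ fromY c d cd cd′ ∷ de ∷
         fromX a e a≤e ae′ ∷ toX e e≤b be′ ∷ a≤e ∷ e≤b ∷
         fromY c e ce ce′ ∷ fromY d e de de′ ∷ ef ∷
         fromX a f a≤f af′ ∷ toX f f≤b bf′ ∷ a≤f ∷ f≤b ∷
         fromY c f cf cf′ ∷ fromY d f df df′ ∷ fromY e f ef ef′ ∷ [])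
      where
      fromX : ∀ p q → X p ≤ X q → dist₁ ℝ p q ≡ ℓ + ℓ → _
      fromX p q p≤q d = trans (xdist p q p≤q) d
      fromY : ∀ p q → Y p ≤ Y q → dist₁ ℝ p q ≡ ℓ + ℓ → _
      fromY p q p≤q d = trans (ydist p q p≤q) d
      toX : ∀ p → X p ≤ X b → dist₁ ℝ b p ≡ ℓ + ℓ → _
      toX p p≤b d = fromX p b p≤b (trans (dist-sym p b) d)

    -- Coordinate exchanges and crosses

    swapXY swapYZ : Point ℝ → Point ℝ
    swapXY (s , t , u) = t , s , u
    swapYZ (s , t , u) = s , u , t

    dist-swapXY : ∀ p q → dist₁ ℝ (swapXY p) (swapXY q) ≡ dist₁ ℝ p q
    dist-swapXY p q = cong (_+ δ (Z p) (Z q)) (+-comm (δ (Y p) (Y q)) (δ (X p) (X q)))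

    dist-swapYZ : ∀ p q → dist₁ ℝ (swapYZ p) (swapYZ q) ≡ dist₁ ℝ p q
    dist-swapYZ p q = begin
      δ (X p) (X q) + δ (Z p) (Z q) + δ (Y p) (Y q)    ≡⟨ +-assoc _ _ _ ⟩
      δ (X p) (X q) + (δ (Z p) (Z q) + δ (Y p) (Y q))  ≡⟨ +-congˡ (+-comm _ _) ⟩
      δ (X p) (X q) + (δ (Y p) (Y q) + δ (Z p) (Z q))  ≡⟨ +-assoc _ _ _ ⟨
      δ (X p) (X q) + δ (Y p) (Y q) + δ (Z p) (Z q)    ∎
      where open ≡-Reasoning

    equilateral-map : ∀ g → (∀ p q → dist₁ ℝ (g p) (g q) ≡ dist₁ ℝ p q) →
      ∀ {ps} → Equilateral ps → Equilateral (map g ps)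
    equilateral-map g isometry eq =
      AllPairs.map⁺ (AllPairs.map (λ {p} {q} h → trans (isometry p q) h) eq)

    cross : Point ℝ → List (Point ℝ)
    cross (s , t , u) =
      (s + ℓ , t , u) ∷ (s + - ℓ , t , u) ∷ (s , t + ℓ , u) ∷ (s , t + - ℓ , u) ∷
      (s , t , u + ℓ) ∷ (s , t , u + - ℓ) ∷ []

    Cross : List (Point ℝ) → Set
    Cross ps = ∃ λ m → ps ↭ cross m

    -- An involution that carries crosses to crosses also pulls them back: it is applied a second
    -- time.
    cross-map⁻ : ∀ g → (∀ p → g (g p) ≡ p) → (∀ m → map g (cross m) ↭ cross (g m)) →
      ∀ {ps} → Cross (map g ps) → Cross ps
    cross-map⁻ g involutive symmetric {ps} (m , σ) = g m , (begin
      ps                ≡⟨ map-id ps ⟨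
      map (λ p → p) ps  ≡⟨ map-cong involutive ps ⟨
      map (g ∘ g) ps    ≡⟨ map-∘ ps ⟩
      map g (map g ps)  ↭⟨ ↭-map g σ ⟩
      map g (cross m)   ↭⟨ symmetric m ⟩
      cross (g m)       ∎)
      where open PermutationReasoning

    cross-swapXY : ∀ {ps} → Cross (map swapXY ps) → Cross ps
    cross-swapXY = cross-map⁻ swapXY (λ _ → refl) (λ m →
      -- The x-pair of tips becomes the y-pair and conversely, so two blocks of length two trade
      -- places.
      ++⁺ʳ _ (++-comm (take 2 (map swapXY (cross m))) (take 2 (cross (swapXY m)))))

    cross-swapYZ : ∀ {ps} → Cross (map swapYZ ps) → Cross ps
    cross-swapYZ = cross-map⁻ swapYZ (λ _ → refl) (λ m → prep _ (prep _
      (++-comm (take 2 (drop 2 (map swapYZ (cross m)))) (take 2 (drop 2 (cross (swapYZ m)))))))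

    slab-swapYZ : ∀ {a b ps} → Slab a b ps → Slab (swapYZ a) (swapYZ b) (map swapYZ ps)
    slab-swapYZ {ps = ps} S = record
      { equilateral = equilateral-map swapYZ dist-swapYZ (Slab.equilateral S)
      ; wide        = Slab.wide S
      ; within      = All.map⁺ (Slab.within S)
      ; four        = trans (length-map swapYZ ps) (Slab.four S)
      }

    -- As a and b differ in x only, the distances of p from them add up to 2ℓ plus twice the
    -- distance of p from their line. The latter is therefore ℓ, and p lies halfway.
    midpoint : ∀ a b p → Y a ≡ Y b → Z a ≡ Z b → X a ≤ X p → X p ≤ X b →
      dist₁ ℝ a b ≡ ℓ + ℓ → dist₁ ℝ a p ≡ ℓ + ℓ → dist₁ ℝ b p ≡ ℓ + ℓ →
      X p ≡ X a + ℓ × X b ≡ X a + ℓ + ℓ × δ (Y a) (Y p) + δ (Z a) (Z p) ≡ ℓ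
    midpoint a b p ya≡yb za≡zb a≤p p≤b ab ap bp =
      linarith ρ {Γ} {x pᵀ ≐ x aᵀ ⊕ l} (checked refl) hs ,
      linarith ρ {Γ} {x bᵀ ≐ x aᵀ ⊕ l ⊕ l} (checked refl) hs ,
      linarith ρ {Γ} {gap (y aᵀ) (y pᵀ) ⊕ gap (z aᵀ) (z pᵀ) ≐ l} (checked refl) hs
      where
      ρ = coords p Vec.++ ℓ ∷ coords b Vec.++ coords a
      aᵀ bᵀ pᵀ : Pointᵀ 10
      pᵀ = var (# 0) , var (# 1) , var (# 2)
      bᵀ = var (# 4) , var (# 5) , var (# 6)
      aᵀ = var (# 7) , var (# 8) , var (# 9)
      l : Term 10
      l = var (# 3)
      Γ : List (Formula 10)
      Γ = (𝟎 ≺ l) ∷ (y aᵀ ≐ y bᵀ) ∷ (z aᵀ ≐ z bᵀ) ∷ (x aᵀ ≼ x pᵀ) ∷ (x pᵀ ≼ x bᵀ) ∷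
          (distᵀ aᵀ bᵀ ≐ l ⊕ l) ∷ (distᵀ aᵀ pᵀ ≐ l ⊕ l) ∷ (distᵀ bᵀ pᵀ ≐ l ⊕ l) ∷ []
      hs = 0<ℓ ∷ ya≡yb ∷ za≡zb ∷ a≤p ∷ p≤b ∷ ab ∷ ap ∷ bp ∷ []

    planar-dist : ∀ p q s → X p ≡ s → X q ≡ s → dist₁ ℝ p q ≡ ℓ + ℓ →
      δ (Y p) (Y q) + δ (Z p) (Z q) ≡ ℓ + ℓ
    planar-dist p q s p≡s q≡s d = trans (sym (+-identityˡ _)) (trans
      (cong (_+ (δ (Y p) (Y q) + δ (Z p) (Z q))) (sym gap≡0))
      (trans (sym (+-assoc _ _ _)) d))
      where
      gap≡0 : δ (X p) (X q) ≡ 0#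
      gap≡0 = trans (δ-ordered (X p) (X q) (inj₂ (trans p≡s (sym q≡s))))
        (trans (cong (_+ - X p) (trans q≡s (sym p≡s))) (-‿inverseʳ (X p)))

    planar-ydist : ∀ p q s → X p ≡ s → X q ≡ s → Y p ≤ Y q → dist₁ ℝ p q ≡ ℓ + ℓ →
      (Y q + - Y p) + δ (Z p) (Z q) ≡ ℓ + ℓ
    planar-ydist p q s p≡s q≡s p≤q d =
      trans (cong (_+ δ (Z p) (Z q)) (sym (δ-ordered (Y p) (Y q) p≤q)))
        (planar-dist p q s p≡s q≡s d)

    OnCircle : Point ℝ → Point ℝ → Set
    OnCircle m p = X p ≡ X m × δ (Y m) (Y p) + δ (Z m) (Z p) ≡ ℓ

    -- The order f, c, e, d is that of `cross`: the y-tips before the z-tips, and the positive tip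
    -- first in each pair.
    planar-cross : ∀ m c d e f → All (OnCircle m) (c ∷ d ∷ e ∷ f ∷ []) →
      Equilateral (c ∷ d ∷ e ∷ f ∷ []) →
      Y c ≤ Y d → Y c ≤ Y e → Y d ≤ Y f → Y e ≤ Y f → Z d ≤ Z e →
      f ∷ c ∷ e ∷ d ∷ [] ≡ drop 2 (cross m)
    planar-cross m c d e f ((xc , oc) ∷ (xd , od) ∷ (xe , oe) ∷ (xf , of) ∷ [])
      ((cd ∷ ce ∷ cf ∷ []) ∷ (de ∷ df ∷ []) ∷ (ef ∷ []) ∷ [] ∷ []) c≤d c≤e d≤f e≤f d≤e =
      cong₂ _∷_ (point-≡ f xf (deduce Planar.f₁) (deduce Planar.f₂))
        (cong₂ _∷_ (point-≡ c xc (deduce Planar.c₁) (deduce Planar.c₂))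
        (cong₂ _∷_ (point-≡ e xe (deduce Planar.e₁) (deduce Planar.e₂))
        (cong (_∷ []) (point-≡ d xd (deduce Planar.d₁) (deduce Planar.d₂)))))
      where
      ρ = Y c ∷ Z c ∷ Y d ∷ Z d ∷ Y e ∷ Z e ∷ Y f ∷ Z f ∷ ℓ ∷ Y m ∷ Z m ∷ []
      c≤f = ≤-trans c≤d d≤f
      hs : All (⟦_⟧ᶠ ρ) Planar.Γ
      hs = 0<ℓ ∷ oc ∷ of ∷ c≤f ∷ planar-ydist c f (X m) xc xf c≤f cf ∷
           c≤d ∷ d≤f ∷ od ∷ planar-ydist c d (X m) xc xd c≤d cd ∷
           planar-ydist d f (X m) xd xf d≤f df ∷
           c≤e ∷ e≤f ∷ d≤e ∷ oe ∷
           planar-ydist c e (X m) xc xe c≤e ce ∷ planar-ydist e f (X m) xe xf e≤f ef ∷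
           planar-dist d e (X m) xd xe de ∷ []
      deduce : ∀ {φ} → Planar.Γ ⊢ φ → ⟦_⟧ᶠ ρ φ
      deduce ok = linarith ρ ok hs

    slab-cross : ∀ a b ps → Slab a b ps → Cross (a ∷ b ∷ ps)
    slab-cross a b ps S with sortBy Y ps
    ... | qs , σ , sorted
      with qs | σ | trans (↭-length σ) (Slab.four S) | All-resp-↭ (↭-sym σ) (Slab.within S) | sorted
         | equilateral-↭ (prep a (prep b (↭-sym σ))) (Slab.equilateral S)
    ... | c ∷ d ∷ e ∷ f ∷ [] | σ | _
        | (a≤c , c≤b) ∷ (a≤d , d≤b) ∷ (a≤e , e≤b) ∷ (a≤f , f≤b) ∷ []
        | (c≤d ∷ c≤e ∷ c≤f ∷ []) ∷ (d≤e ∷ d≤f ∷ []) ∷ (e≤f ∷ []) ∷ [] ∷ []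
        | (ab ∷ ac ∷ ad ∷ ae ∷ af ∷ []) ∷ (bc ∷ bd ∷ be ∷ bf ∷ []) ∷ eq =
      -- `cross` lists the tip at + ℓ first, hence b before a.
      m , ↭-trans (swap a b (↭-trans (↭-sym σ) (tips (≤-or-> (Z d) (Z e)))))
        (↭-reflexive (cong₂ (λ p q → p ∷ q ∷ drop 2 (cross m)) b≡ a≡))
      where
      m : Point ℝ
      -- Halfway between a and b, which turn out to be 2ℓ apart in x.
      m = X a + ℓ , Y a , Z a

      ya≡yb = slab-level a b ps S
      za≡zb = slab-level _ _ _ (slab-swapYZ S)

      mid : ∀ p → X a ≤ X p → X p ≤ X b → dist₁ ℝ a p ≡ ℓ + ℓ → dist₁ ℝ b p ≡ ℓ + ℓ →
        X p ≡ X a + ℓ × X b ≡ X a + ℓ + ℓ × δ (Y a) (Y p) + δ (Z a) (Z p) ≡ ℓ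
      mid p a≤p p≤b = midpoint a b p ya≡yb za≡zb a≤p p≤b ab

      circle : ∀ p → X a ≤ X p → X p ≤ X b →
        dist₁ ℝ a p ≡ ℓ + ℓ → dist₁ ℝ b p ≡ ℓ + ℓ → OnCircle m p
      circle p a≤p p≤b ap bp with mid p a≤p p≤b ap bp
      ... | xp , _ , op = xp , op

      b≡ : b ≡ (X a + ℓ + ℓ , Y a , Z a)
      b≡ = point-≡ b (proj₁ (proj₂ (mid c a≤c c≤b ac bc))) (sym ya≡yb) (sym za≡zb)

      a≡ : a ≡ (X a + ℓ + - ℓ , Y a , Z a)
      a≡ = point-≡ a (sym (trans (+-assoc _ _ _) (trans (+-congˡ (-‿inverseʳ ℓ)) (+-identityʳ _))))
        refl refl

      circles = circle c a≤c c≤b ac bc ∷ circle d a≤d d≤b ad bd ∷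
                circle e a≤e e≤b ae be ∷ circle f a≤f f≤b af bf ∷ []

      -- Sorting by y identifies c and f, but d and e both come to lie level with m in y, so z has
      -- to tell them apart.
      tips : Z d ≤ Z e ⊎ Z e < Z d → c ∷ d ∷ e ∷ f ∷ [] ↭ drop 2 (cross m)
      tips (inj₁ d≤e) = ↭-trans (++-comm (c ∷ d ∷ e ∷ []) (f ∷ []))
        (↭-trans (prep f (prep c (swap d e ↭-refl)))
        (↭-reflexive (planar-cross m c d e f circles eq c≤d c≤e d≤f e≤f d≤e)))
      tips (inj₂ e<d) = ↭-trans (++-comm (c ∷ d ∷ e ∷ []) (f ∷ []))
        (↭-reflexive (planar-cross m c e d f (All-resp-↭ σ′ circles) (equilateral-↭ σ′ eq)
          c≤e c≤d e≤f d≤f (inj₁ e<d)))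
        where
        σ′ : c ∷ d ∷ e ∷ f ∷ [] ↭ c ∷ e ∷ d ∷ f ∷ []
        σ′ = prep c (swap d e ↭-refl)

    -- The points extreme in x decide: more than ℓ apart they bound a slab, and otherwise the first
    -- of them is the lower end of a narrow interval.
    cross-or-narrow : ∀ ps → length ps ≡ 6 → Equilateral ps → Cross ps ⊎ Narrow X ps
    cross-or-narrow ps six eq with sortBy X ps
    ... | qs , σ , sorted
      with qs | σ | trans (↭-length σ) six | sorted | equilateral-↭ (↭-sym σ) eq
    ... | a ∷ c ∷ d ∷ e ∷ f ∷ b ∷ [] | σ | _
        | (a≤c ∷ a≤d ∷ a≤e ∷ a≤f ∷ a≤b ∷ []) ∷ (_ ∷ _ ∷ _ ∷ c≤b ∷ []) ∷ (_ ∷ _ ∷ d≤b ∷ []) ∷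
          (_ ∷ e≤b ∷ []) ∷ (f≤b ∷ []) ∷ [] ∷ []
        | eq′
      with ≤-or-> (X b) (X a + ℓ)
    ... | inj₁ b≤a+ℓ = inj₂ (X a , All-resp-↭ σ
      ((inj₂ refl , ≤-trans a≤b b≤a+ℓ) ∷ (a≤c , ≤-trans c≤b b≤a+ℓ) ∷ (a≤d , ≤-trans d≤b b≤a+ℓ) ∷
       (a≤e , ≤-trans e≤b b≤a+ℓ) ∷ (a≤f , ≤-trans f≤b b≤a+ℓ) ∷ (a≤b , b≤a+ℓ) ∷ []))
    ... | inj₂ a+ℓ<b = inj₁ (map₂ (↭-trans (↭-trans (↭-sym σ) τ)) (slab-cross a b _ record
      { equilateral = equilateral-↭ τ eq′
      ; wide        = a+ℓ<b
      ; within      = (a≤c , c≤b) ∷ (a≤d , d≤b) ∷ (a≤e , e≤b) ∷ (a≤f , f≤b) ∷ []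
      ; four        = refl
      }))
      where
      τ : a ∷ c ∷ d ∷ e ∷ f ∷ b ∷ [] ↭ a ∷ b ∷ c ∷ d ∷ e ∷ f ∷ []
      τ = prep a (++-comm (c ∷ d ∷ e ∷ f ∷ []) (b ∷ []))

    -- Each coordinate is brought into first place in turn; z gets there by `swapYZ` followed by
    -- `swapXY`. A cross found on the way is carried back, and three narrow coordinates are
    -- impossible.
    six⇒cross : ∀ ps → length ps ≡ 6 → Equilateral ps → Cross ps
    six⇒cross ps six eq
      with cross-or-narrow ps six eq
         | cross-or-narrow (map swapXY ps) (trans (length-map swapXY ps) six) eqXY
         | cross-or-narrow (map swapXY (map swapYZ ps))
             (trans (length-map swapXY (map swapYZ ps)) (trans (length-map swapYZ ps) six)) eqXYZ
      where
      eqXY  = equilateral-map swapXY dist-swapXY eq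
      eqXYZ = equilateral-map swapXY dist-swapXY (equilateral-map swapYZ dist-swapYZ eq)
    ... | inj₁ C | _ | _ = C
    ... | inj₂ _ | inj₁ C | _ = cross-swapXY C
    ... | inj₂ _ | inj₂ _ | inj₁ C = cross-swapYZ (cross-swapXY C)
    ... | inj₂ narrowX | inj₂ (loY , inY) | inj₂ (loZ , inZ) = ⊥-elim
      (¬all-narrow ps six eq narrowX (loY , All.map⁻ inY) (loZ , All.map⁻ (All.map⁻ inZ)))

    -- Equal distances from opposite tips force each coordinate of p to be that of the centre, which
    -- is only ℓ away from the tips.
    ¬equidistant-from-cross : ∀ m p → All (λ q → dist₁ ℝ p q ≡ ℓ + ℓ) (cross m) → ⊥
    ¬equidistant-from-cross m p (h₁ ∷ h₂ ∷ h₃ ∷ h₄ ∷ h₅ ∷ h₆ ∷ []) = irrefl refl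
      (linarith (coords p Vec.++ ℓ ∷ coords m)
        {(𝟎 ≺ l) ∷
         (distᵀ pᵀ (s ⊕ l , t , u) ≐ l ⊕ l) ∷ (distᵀ pᵀ (s ⊕ ⊝ l , t , u) ≐ l ⊕ l) ∷
         (distᵀ pᵀ (s , t ⊕ l , u) ≐ l ⊕ l) ∷ (distᵀ pᵀ (s , t ⊕ ⊝ l , u) ≐ l ⊕ l) ∷
         (distᵀ pᵀ (s , t , u ⊕ l) ≐ l ⊕ l) ∷ (distᵀ pᵀ (s , t , u ⊕ ⊝ l) ≐ l ⊕ l) ∷ []}
        {l ≺ l} (checked refl) (0<ℓ ∷ h₁ ∷ h₂ ∷ h₃ ∷ h₄ ∷ h₅ ∷ h₆ ∷ []))
      where
      pᵀ : Pointᵀ 7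
      pᵀ = var (# 0) , var (# 1) , var (# 2)
      l s t u : Term 7
      l = var (# 3)
      s = var (# 4)
      t = var (# 5)
      u = var (# 6)

    equilateral⇒length≤6 : ∀ ps → Equilateral ps → length ps ℕ.≤ 6
    equilateral⇒length≤6 ps eq with length ps ℕ.≤? 6
    ... | yes ≤6 = ≤6
    ... | no  ≰6
      -- Of the first seven points, the last six form a cross, and the head is at distance 2ℓ from
      -- all its tips.
      with take 7 ps | trans (length-take 7 ps) (ℕ.m≤n⇒m⊓n≡m (ℕ.≰⇒> ≰6)) | AllPairs.take⁺ 7 eq
    ...   | q ∷ qs | seven | far ∷ eq′ with six⇒cross qs (ℕ.suc-injective seven) eq′
    ...     | m , σ = ⊥-elim (¬equidistant-from-cross m q (All-resp-↭ σ far))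

-- Similarity to the cross

module Theorem (ℝ : RealField) where
  open RealField ℝ hiding (_≤_)
  open OrderedField ℝ
  open Equilateral ℝ
  open IsStrictTotalOrder isStrictTotalOrder using (compare; irrefl)

  open CommutativeRing commutativeRing using
    (+-comm; +-identityˡ; *-identityʳ; *-comm; *-assoc; zeroʳ; distribˡ; distribʳ; ring)
  open Algebra.Properties.Ring ring
    using (-‿injective; +-cancelʳ; -‿distribˡ-*; -‿distribʳ-*; -‿involutive)

  0<1 : 0# < 1#
  0<1 with compare 0# 1#
  ... | tri< 0<1 _ _ = 0<1
  ... | tri≈ _ 0≡1 _ = ⊥-elim (0≢1 0≡1)
  -- Even here the goal follows: - 1 would be positive, and with it its square 1.
  ... | tri> _ _ 1<0 = subst (0# <_) [-1]²≡1 (*-pos 0<-1 0<-1)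
    where
    0<-1 : 0# < - 1#
    0<-1 = subst (0# <_) (+-identityˡ (- 1#)) (<⇒0< 1<0)
    [-1]²≡1 : - 1# * - 1# ≡ 1#
    [-1]²≡1 = begin
      - 1# * - 1#      ≡⟨ -‿distribˡ-* 1# (- 1#) ⟨
      - (1# * - 1#)    ≡⟨ cong -_ (-‿distribʳ-* 1# 1#) ⟨
      - - (1# * 1#)    ≡⟨ -‿involutive _ ⟩
      1# * 1#          ≡⟨ *-identityʳ 1# ⟩
      1#               ∎
      where open ≡-Reasoning

  <⇒≢ : ∀ {s t} → s < t → ¬ s ≡ t
  <⇒≢ s<t s≡t = irrefl s≡t s<t

  -1<0 : - 1# < 0#
  -1<0 = linarith (1# ∷ []) {(𝟎 ≺ var (# 0)) ∷ []} {⊝ var (# 0) ≺ 𝟎} (checked refl) (0<1 ∷ [])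

  -1<1 : - 1# < 1#
  -1<1 = linarith (1# ∷ []) {(𝟎 ≺ var (# 0)) ∷ []} {⊝ var (# 0) ≺ var (# 0)}
    (checked refl) (0<1 ∷ [])

  -- This supplies the radius ℓ with D = 2ℓ; 1 + 1 is invertible because it is positive.
  halve : ∀ s → ∃ λ h → s ≡ h + h
  halve s with inverse (1# + 1#) (<⇒≢ (+-pos 0<1 0<1) ∘ sym)
  ... | h , 2h≡1 = s * h , (begin
    s                    ≡⟨ *-identityʳ s ⟨
    s * 1#               ≡⟨ cong (s *_) 2h≡1 ⟨
    s * ((1# + 1#) * h)  ≡⟨ *-assoc s (1# + 1#) h ⟨
    s * (1# + 1#) * h    ≡⟨ cong (_* h) (distribˡ s 1# 1#) ⟩
    (s * 1# + s * 1#) * h  ≡⟨ cong₂ (λ t u → (t + u) * h) (*-identityʳ s) (*-identityʳ s) ⟩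
    (s + s) * h          ≡⟨ distribʳ h s s ⟩
    s * h + s * h        ∎)
    where open ≡-Reasoning

  *-cancelˡ-pos : ∀ {c s t} → 0# < c → c * s ≡ c * t → s ≡ t
  *-cancelˡ-pos {c} {s} {t} 0<c eq with inverse c (<⇒≢ 0<c ∘ sym)
  ... | d , cd≡1 = begin
    s            ≡⟨ *-identityʳ s ⟨
    s * 1#       ≡⟨ unscale s ⟩
    d * (c * s)  ≡⟨ cong (d *_) eq ⟩
    d * (c * t)  ≡⟨ unscale t ⟨
    t * 1#       ≡⟨ *-identityʳ t ⟩
    t            ∎
    where
    open ≡-Reasoning
    unscale : ∀ u → u * 1# ≡ d * (c * u)
    unscale u = begin
      u * 1#       ≡⟨ cong (u *_) cd≡1 ⟨
      u * (c * d)  ≡⟨ *-comm u (c * d) ⟩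
      c * d * u    ≡⟨ cong (_* u) (*-comm c d) ⟩
      d * c * u    ≡⟨ *-assoc d c u ⟩
      d * (c * u)  ∎

  module _ (f : L1Similarity ℝ) where
    open L1Similarity f

    coord-injective : ∀ p q i → coord ℝ (apply p) i ≡ coord ℝ (apply q) i →
      coord ℝ p (perm ⟨$⟩ʳ i) ≡ coord ℝ q (perm ⟨$⟩ʳ i)
    -- `coord` and `fromCoords` compute at concrete indices only, hence one clause for each;
    -- splitting on the sign unfolds `sgn`.
    coord-injective p q zero eq with signs zero
    ... | true  = *-cancelˡ-pos scale-pos (+-cancelʳ _ _ _ eq)
    ... | false = -‿injective (*-cancelˡ-pos scale-pos (+-cancelʳ _ _ _ eq))
    coord-injective p q (suc zero) eq with signs (suc zero)
    ... | true  = *-cancelˡ-pos scale-pos (+-cancelʳ _ _ _ eq)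
    ... | false = -‿injective (*-cancelˡ-pos scale-pos (+-cancelʳ _ _ _ eq))
    coord-injective p q (suc (suc zero)) eq with signs (suc (suc zero))
    ... | true  = *-cancelˡ-pos scale-pos (+-cancelʳ _ _ _ eq)
    ... | false = -‿injective (*-cancelˡ-pos scale-pos (+-cancelʳ _ _ _ eq))

    apply-injective : ∀ {p q} → apply p ≡ apply q → p ≡ q
    apply-injective {p} {q} eq = point-≡ p (agree zero) (agree (suc zero)) (agree (suc (suc zero)))
      where
      agree : ∀ i → coord ℝ p i ≡ coord ℝ q i
      agree i = subst (λ j → coord ℝ p j ≡ coord ℝ q j) (inverseʳ perm)
        -- Coordinate i is read off from the output coordinate that `perm` sends to i.
        (coord-injective p q (perm ⟨$⟩ˡ i) (cong (λ r → coord ℝ r (perm ⟨$⟩ˡ i)) eq))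

  Λ₃-unique : Unique (Λ₃-list ℝ)
  Λ₃-unique =
    (-1≢1 ∘ sym ∘ cong X ∷ 1≢0 ∘ cong X ∷ 1≢0 ∘ cong X ∷ 1≢0 ∘ cong X ∷ 1≢0 ∘ cong X ∷ []) ∷
    (-1≢0 ∘ cong X ∷ -1≢0 ∘ cong X ∷ -1≢0 ∘ cong X ∷ -1≢0 ∘ cong X ∷ []) ∷
    (-1≢1 ∘ sym ∘ cong Y ∷ 1≢0 ∘ cong Y ∷ 1≢0 ∘ cong Y ∷ []) ∷
    (-1≢0 ∘ cong Y ∷ -1≢0 ∘ cong Y ∷ []) ∷
    (-1≢1 ∘ sym ∘ cong Z ∷ []) ∷ [] ∷ []
    where
    1≢0  = <⇒≢ 0<1 ∘ sym
    -1≢0 = <⇒≢ -1<0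
    -1≢1 = <⇒≢ -1<1

  module _ {ℓ : R} (0<ℓ : 0# < ℓ) (m : Point ℝ) where
    ℓΛ₃+m : L1Similarity ℝ
    ℓΛ₃+m = record
      { perm = Permutation.id ; signs = λ _ → true ; scale = ℓ ; scale-pos = 0<ℓ ; shift = m }

    map-Λ₃≡cross : map (L1Similarity.apply ℓΛ₃+m) (Λ₃-list ℝ) ≡ cross ℓ 0<ℓ m
    map-Λ₃≡cross =
      cong₂ _∷_ (point (plus (X m)) (null (Y m)) (null (Z m)))
      (cong₂ _∷_ (point (minus (X m)) (null (Y m)) (null (Z m)))
      (cong₂ _∷_ (point (null (X m)) (plus (Y m)) (null (Z m)))
      (cong₂ _∷_ (point (null (X m)) (minus (Y m)) (null (Z m)))
      (cong₂ _∷_ (point (null (X m)) (null (Y m)) (plus (Z m)))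
      (cong (_∷ []) (point (null (X m)) (null (Y m)) (minus (Z m))))))))
      where
      point : ∀ {s s′ t t′ u u′ : R} → s ≡ s′ → t ≡ t′ → u ≡ u′ → (s , t , u) ≡ (s′ , t′ , u′)
      point s≡ t≡ u≡ = cong₂ _,_ s≡ (cong₂ _,_ t≡ u≡)
      plus : ∀ s → ℓ * 1# + s ≡ s + ℓ
      plus s = trans (cong (_+ s) (*-identityʳ ℓ)) (+-comm ℓ s)
      minus : ∀ s → ℓ * - 1# + s ≡ s + - ℓ
      minus s = trans (cong (_+ s) (trans (sym (-‿distribʳ-* ℓ 1#)) (cong -_ (*-identityʳ ℓ))))
        (+-comm (- ℓ) s)
      null : ∀ s → ℓ * 0# + s ≡ s
      null s = trans (cong (_+ s) (zeroʳ ℓ)) (+-identityˡ s)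

  -- This turns a similarity from P onto Λ₃ into an explicit list of points of P.
  preimages : ∀ {A B : Set} {P : A → Set} {f : A → B} {ys} → All (λ y → ∃ λ x → P x × f x ≡ y) ys →
    ∃ λ xs → All P xs × map f xs ≡ ys
  preimages []                  = [] , [] , refl
  preimages ((x , px , eq) ∷ h) with preimages h
  ... | xs , pxs , eqs = x ∷ xs , px ∷ pxs , cong₂ _∷_ eq eqs

  -- P is an arbitrary predicate, so its cardinality is expressed by an enumeration without
  -- repetition.
  SixElements : Subset ℝ → Set
  SixElements P = ∃ λ (xs : List (Point ℝ)) →
    Unique xs × All P xs × (∀ x → P x → x ∈ xs) × length xs ≡ 6

  -- If P is mapped onto Λ₃, chosen preimages of the six vectors are distinct because their images
  -- are, and injectivity shows that no point of P is missed. If Λ₃ is mapped onto P, the six images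
  -- enumerate P.
  similar⇒six : ∀ P → L1Similar ℝ P (Λ₃ ℝ) → SixElements P
  similar⇒six P (inj₁ (f , fP≡Λ)) with preimages {f = apply} (All.tabulate (proj₂ (fP≡Λ _)))
    where open L1Similarity f
  ... | xs , pxs , fxs≡Λ = xs ,
    Unique.map⁻ (subst Unique (sym fxs≡Λ) Λ₃-unique) , pxs , complete ,
    trans (sym (length-map apply xs)) (cong length fxs≡Λ)
    where
    open L1Similarity f
    complete : ∀ x → P x → x ∈ xs
    complete x px with ∈-map⁻ apply
      (subst (apply x ∈_) (sym fxs≡Λ) (proj₁ (fP≡Λ (apply x)) (x , px , refl)))
    ... | x′ , x′∈xs , eq = subst (_∈ xs) (sym (apply-injective f eq)) x′∈xs
  similar⇒six P (inj₂ (f , fΛ≡P)) = map apply (Λ₃-list ℝ) ,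
    Unique.map⁺ (apply-injective f) Λ₃-unique ,
    All.map⁺ (All.tabulate (λ {v} v∈Λ → proj₁ (fΛ≡P (apply v)) (v , v∈Λ , refl))) ,
    complete , refl
    where
    open L1Similarity f
    complete : ∀ x → P x → x ∈ map apply (Λ₃-list ℝ)
    complete x px with proj₂ (fΛ≡P x) px
    ... | v , v∈Λ , refl = ∈-map⁺ apply v∈Λ

  six⇒similar : ∀ P {ℓ} (0<ℓ : 0# < ℓ) → (∀ {xs} → Unique xs → All P xs → Equilateral ℓ 0<ℓ xs) →
    SixElements P → L1Similar ℝ P (Λ₃ ℝ)
  six⇒similar P {ℓ} 0<ℓ equi (xs , unique , pxs , complete , six)
    with six⇒cross ℓ 0<ℓ xs six (equi unique pxs)
  -- The similarity runs from Λ₃ to P, as its scale ℓ and shift m can then be read off the cross.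
  ... | m , σ = inj₂ (f , λ x → fΛ⊆P x , P⊆fΛ x)
    where
    f = ℓΛ₃+m 0<ℓ m
    open L1Similarity f
    fΛ⊆P : ∀ x → Image ℝ apply (Λ₃ ℝ) x → P x
    fΛ⊆P _ (v , v∈Λ , refl) = All.lookup pxs (∈-resp-↭ (↭-sym σ)
      (subst (apply v ∈_) (map-Λ₃≡cross 0<ℓ m) (∈-map⁺ apply v∈Λ)))
    P⊆fΛ : ∀ x → P x → Image ℝ apply (Λ₃ ℝ) x
    P⊆fΛ x px with ∈-map⁻ apply
      (subst (x ∈_) (sym (map-Λ₃≡cross 0<ℓ m)) (∈-resp-↭ σ (complete x px)))
    ... | v , v∈Λ , x≡ = v , v∈Λ , sym x≡

  module _ (P : Subset ℝ) {ℓ : R} (0<ℓ : 0# < ℓ)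
    (single : ∀ x y → P x → P y → ¬ x ≡ y → dist₁ ℝ x y ≡ ℓ + ℓ) where

    equilateral : ∀ {xs} → Unique xs → All P xs → Equilateral ℓ 0<ℓ xs
    equilateral []            []         = []
    equilateral (x≢ ∷ unique) (px ∷ pxs) =
      All.zipWith (λ (x≢y , py) → single _ _ px py x≢y) (x≢ , pxs) ∷ equilateral unique pxs

  singleDistance⇒radius : ∀ P → SingleDistance ℝ P →
    ∃ λ ℓ → 0# < ℓ × (∀ x y → P x → P y → ¬ x ≡ y → dist₁ ℝ x y ≡ ℓ + ℓ)
  singleDistance⇒radius P (λ₀ , (p , q , _ , _ , p≢q , pq≡λ₀) , single) with halve λ₀
  ... | ℓ , refl with ≤-or-> (dist₁ ℝ p q) 0#
  -- The common distance is positive because it is attained by distinct points.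
  ...   | inj₁ d≤0 = ⊥-elim (p≢q (dist≤0⇒≡ p q d≤0))
  ...   | inj₂ 0<d = ℓ , 0<ℓ , single
    where
    0<ℓ : 0# < ℓ
    0<ℓ = linarith (ℓ ∷ []) {(𝟎 ≺ var (# 0) ⊕ var (# 0)) ∷ []} {𝟎 ≺ var (# 0)} (checked refl)
      (subst (0# <_) pq≡λ₀ 0<d ∷ [])

open import Data.Nat using (_≤_)

theorem2p6 : (ℝ : RealField) → (P : Subset ℝ) → SingleDistance ℝ P →
    ((xs : List (Point ℝ)) → Unique xs → All P xs → length xs ≤ 6) ×
    ((∃ λ (xs : List (Point ℝ)) → Unique xs × All P xs × (∀ x → P x → x ∈ xs) × length xs ≡ 6)
    ⇔ L1Similar ℝ P (Λ₃ ℝ))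
theorem2p6 ℝ P SD with Theorem.singleDistance⇒radius ℝ P SD
... | ℓ , 0<ℓ , single =
  (λ xs unique pxs → equilateral⇒length≤6 ℓ 0<ℓ xs (equilateral P 0<ℓ single unique pxs)) ,
  mk⇔ (six⇒similar P 0<ℓ (equilateral P 0<ℓ single)) (similar⇒six P)
  where
  open Theorem ℝ
  open Equilateral ℝ
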